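{- (1) For $n\ge 0$ let $S_n$ be the star graph on $n+1$ vertices (a central vertex adjacent to $n$ leaves). Then $\hom(S_q,S_n)=n^q+n$ for $q\ge1$, and this family of polynomials in $n$ (indexed by $q\ge 1$) is a two-level polynomial of degree function $q$ and depth exactly $q-2$. (2) For $q\ge1$, $\hom(K_q,K_{n^2}\sqcup K_n)=(n^2)_q+(n)_q$, where $K_m$ is the complete graph on $m$ vertices, $\sqcup$ is disjoint union, and $(x)_q=x(x-1)\cdots(x-q+1)$. This family of polynomials in $n$ (indexed by $q\ge1$) is a two-level polynomial of degree function $2q$ and depth exactly $q-1$. Here "depth exactly $e(q)$" means that $e$ is a valid depth function, and any valid depth function $e'$ with $e'(q)\ge e(q)$ for all $q\ge1$ satisfies $e'=e$.
   Context: Graphs are finite and simple; $\hom(F,G)$ denotes the number of graph homomorphisms from $F$ to $G$. Two-level polynomial (index set $q\ge1$): let $g$ be a polynomial taking nonnegative integer values at integers $q\ge 1$, and let $e:\{1,2,\dots\}\to\mathbb N\cup\{ -1,\infty\}$. A sequence of polynomials $\{f_q(n)\}_{q\ge1}$, with $f_q$ of degree $g(q)$, is a two-level polynomial of degree function $g$ and depth function $e$ if, writing $f_q(n)=\sum_{r=0}^\infty c_r(q)n^{g(q)-r}$ with $c_r(q)=0$ for $r>g(q)$, there exist polynomials $\{\varphi_r(q)\}_{r\ge0}$ such that $c_r(q)=\varphi_r(q)$ for every $q\ge1$ and every $r\le e(q)$; such an $e$ is called a valid depth function. -}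

module Defs where

open import Algebra.Bundles using (RawRing)
import Algebra.Definitions.RawMonoid as RawMonoidDefs
import Algebra.Definitions.RawSemiring as RawSemiringDefs
open import Data.Empty using (⊥)
open import Data.Fin using (Fin; zero; suc; splitAt; finToFun)
open import Data.Fin.Properties using (_≟_; all?)
open import Data.Integer.Base using (+_)
open import Data.List.Base using (List; []; _∷_; map; length; filter; allFin)
open import Data.Nat.Base using (ℕ; zero; suc; _∸_; _^_; _<_; NonZero)
  renaming (_+_ to _+ℕ_; _≤_ to _≤ℕ_)
open import Data.Nat.Properties using (_≤?_)
open import Data.Product.Base using (_×_)
open import Data.Rational.Base using (ℚ; 0ℚ; 1ℚ; _/_)
  renaming (_+_ to _+ℚ_; _*_ to _*ℚ_; -_ to -ℚ_)
open import Data.Sum.Relation.Binary.Pointwise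
  using (Pointwise; ⊎-symmetric; ⊎-decidable; inj₁; inj₂)
open import Data.Sum.Base using (_⊎_)
open import Level using (0ℓ)
open import Relation.Binary.Construct.Add.Extrema.NonStrict _≤ℕ_ public
  using (_≤±_)
open import Relation.Binary.Core using (Rel)
open import Relation.Binary.Definitions using (Decidable; Irreflexive; Symmetric)
open import Relation.Binary.PropositionalEquality using (_≡_; _≢_; refl)
open import Relation.Nullary.Construct.Add.Extrema using (_±; ⊥±; [_])
open import Relation.Nullary.Decidable using (Dec; yes; no; ¬?; _→-dec_)

record Graph : Set₁ where
  field
    order  : ℕ
    Adj    : Rel (Fin order) 0ℓ
    symm   : Symmetric Adj
    irrefl : Irreflexive _≡_ Adj
    adj?   : Decidable Adj

open Graph public

IsHom : (F G : Graph) → (Fin (order F) → Fin (order G)) → Set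
IsHom F G h = ∀ u v → Adj F u v → Adj G (h u) (h v)

isHom? : (F G : Graph) (h : Fin (order F) → Fin (order G)) → Dec (IsHom F G h)
isHom? F G h = all? λ u → all? λ v → adj? F u v →-dec adj? G (h u) (h v)

-- finToFun enumerates the maps V(F) → V(G), each exactly once.
hom : Graph → Graph → ℕ
hom F G =
  length (filter (λ i → isHom? F G (finToFun i)) (allFin (order G ^ order F)))

K : ℕ → Graph
K m = record
  { order  = m
  ; Adj    = _≢_
  ; symm   = λ u≢v → λ { refl → u≢v refl }
  ; irrefl = λ u≡v u≢v → u≢v u≡v
  ; adj?   = λ u v → ¬? (u ≟ v)
  }

data StarAdj {n : ℕ} : Rel (Fin (suc n)) 0ℓ where
  centre-leaf : ∀ i → StarAdj zero (suc i)
  leaf-centre : ∀ i → StarAdj (suc i) zero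

S : ℕ → Graph
S n = record
  { order  = suc n
  ; Adj    = StarAdj
  ; symm   = λ { (centre-leaf i) → leaf-centre i ; (leaf-centre i) → centre-leaf i }
  ; irrefl = λ { refl () }
  ; adj?   = adj
  }
  where
  adj : Decidable (StarAdj {n})
  adj zero    zero    = no λ ()
  adj zero    (suc i) = yes (centre-leaf i)
  adj (suc i) zero    = yes (leaf-centre i)
  adj (suc i) (suc j) = no λ ()

infixr 5 _⊔_

_⊔_ : Graph → Graph → Graph
G ⊔ H = record
  { order  = order G +ℕ order H
  ; Adj    = λ u v → Sum (splitAt (order G) u) (splitAt (order G) v)
  ; symm   = ⊎-symmetric (symm G) (symm H)
  ; irrefl = λ { {u} refl → sumIrrefl (splitAt (order G) u) }
  ; adj?   = λ u v → ⊎-decidable (adj? G) (adj? H) (splitAt (order G) u) (splitAt (order G) v)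
  }
  where
  Sum : Rel (Fin (order G) ⊎ Fin (order H)) 0ℓ
  Sum = Pointwise (Adj G) (Adj H)
  sumIrrefl : ∀ x → Sum x x → ⊥
  sumIrrefl _ (inj₁ a) = irrefl G refl a
  sumIrrefl _ (inj₂ a) = irrefl H refl a

-- Univariate polynomials over ℚ, as coefficient lists with the constant
-- term first. Trailing zeros are allowed, so a polynomial has several
-- representations; everything below depends only on the coefficients.

Poly : Set
Poly = List ℚ

coeff : Poly → ℕ → ℚ
coeff []      _       = 0ℚ
coeff (a ∷ p) zero    = a
coeff (a ∷ p) (suc k) = coeff p k

eval : Poly → ℚ → ℚ
eval []      x = 0ℚ
eval (a ∷ p) x = a +ℚ x *ℚ eval p x

infixl 6 _+ₚ_
infixl 7 _*ₚ_

_+ₚ_ : Poly → Poly → Poly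
[]      +ₚ q       = q
(a ∷ p) +ₚ []      = a ∷ p
(a ∷ p) +ₚ (b ∷ q) = (a +ℚ b) ∷ (p +ₚ q)

_*ₚ_ : Poly → Poly → Poly
[]      *ₚ q = []
(a ∷ p) *ₚ q = map (a *ℚ_) q +ₚ (0ℚ ∷ (p *ₚ q))

polyRawRing : RawRing 0ℓ 0ℓ
polyRawRing = record
  { Carrier = Poly
  ; _≈_     = λ p q → ∀ k → coeff p k ≡ coeff q k
  ; _+_     = _+ₚ_
  ; _*_     = _*ₚ_
  ; -_      = map -ℚ_
  ; 0#      = []
  ; 1#      = 1ℚ ∷ []
  }

open RawSemiringDefs (RawRing.rawSemiring polyRawRing) public
  using () renaming (_^_ to _^ₚ_)

X : Poly
X = 0ℚ ∷ 1ℚ ∷ []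

fromℕ : ℕ → ℚ
fromℕ n = + n / 1

const : ℕ → Poly
const n = fromℕ n ∷ []

HasDegree : Poly → ℕ → Set
HasDegree p d = coeff p d ≢ 0ℚ × (∀ k → d < k → coeff p k ≡ 0ℚ)

-- falling x q is (x)_q = x (x - 1) ⋯ (x - q + 1).
module _ {c ℓ} (R : RawRing c ℓ) where
  open RawRing R
  open RawMonoidDefs +-rawMonoid using () renaming (_×_ to _·_)

  falling : Carrier → ℕ → Carrier
  falling x zero    = 1#
  falling x (suc q) = falling x q * (x + - (q · 1#))

Seq⁺ : Set → Set
Seq⁺ A = (q : ℕ) → .{{NonZero q}} → A

-- ℕ ∪ {-1, ∞}, with ⊥± in the role of -1 and ⊤± in the role of ∞.
Depth : Set
Depth = ℕ ±

infix 8 _⊖1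

-- k - 1, as an element of ℕ ∪ {-1, ∞}.
_⊖1 : ℕ → Depth
zero  ⊖1 = ⊥±
suc k ⊖1 = [ k ]

-- The coefficient of n^(d - r), read as 0 when r > d.
topCoeff : Poly → ℕ → ℕ → ℚ
topCoeff p d r with r ≤? d
... | yes _ = coeff p (d ∸ r)
... | no  _ = 0ℚ

record IsTwoLevel (f : Seq⁺ Poly) (g : Poly) (e : Seq⁺ Depth) : Set where
  field
    deg      : Seq⁺ ℕ
    g-values : ∀ q .{{_ : NonZero q}} → eval g (fromℕ q) ≡ fromℕ (deg q)
    f-degree : ∀ q .{{_ : NonZero q}} → HasDegree (f q) (deg q)
    φ        : ℕ → Poly
    agree    : ∀ q .{{_ : NonZero q}} r → [ r ] ≤± e q →
               topCoeff (f q) (deg q) r ≡ eval (φ r) (fromℕ q)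

IsTwoLevelOfExactDepth : Seq⁺ Poly → Poly → Seq⁺ Depth → Set
IsTwoLevelOfExactDepth f g e =
  IsTwoLevel f g e ×
  (∀ (e′ : Seq⁺ Depth) → IsTwoLevel f g e′ →
   (∀ q .{{_ : NonZero q}} → e q ≤± e′ q) →
   ∀ q .{{_ : NonZero q}} → e′ q ≡ e q)

module Submission where

open import Defs
open import Algebra.Bundles using (RawRing)
import Algebra.Definitions.RawMonoid as RawMonoidDefs
import Algebra.Properties.Semiring.Sum as SemiringSum
open import Data.Bool.Base using (if_then_else_)
open import Data.Fin.Base using (Fin; zero; suc; _↑ˡ_; _↑ʳ_; combine; splitAt; finToFun; join)
open import Data.Fin.Properties as Fin
  using (_≟_; all?; remQuot-combine; splitAt-↑ˡ; splitAt-↑ʳ; join-splitAt)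
open import Data.Integer.Base using (+_; +-*-rawRing) renaming (_+_ to _+ℤ_)
import Data.Integer.Base as ℤ
import Data.Integer.Properties as ℤ
open import Data.Integer.Solver renaming (module +-*-Solver to ℤ-Solver)
open import Data.List.Base using (List; []; _∷_; map; length; filter; tabulate)
open import Data.Nat.Base
  using (ℕ; zero; suc; NonZero; pred; _+_; _*_; _∸_; _^_; _≤_; _<_; z≤n; s≤s; >-nonZero⁻¹)
open import Data.Nat.Coprimality using (1-coprimeTo) renaming (sym to coprime-sym)
open import Data.Nat.Properties as ℕ
  using (_≤?_; +-assoc; +-comm; +-suc; +-identityʳ; *-identityˡ; *-identityʳ; ^-zeroˡ;
         suc-injective; m≤m+n; m+[n∸m]≡n; m+n∸n≡m)
open import Data.Product.Base using (_×_; _,_; proj₁; proj₂)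
open import Data.Rational.Base as ℚ using (ℚ; 0ℚ; 1ℚ; mkℚ; 1/_)
  renaming (_+_ to _+ℚ_; _*_ to _*ℚ_; -_ to -ℚ_)
import Data.Rational.Properties as ℚ
open import Data.Rational.Solver renaming (module +-*-Solver to ℚ-Solver)
open import Data.Sum.Base using (_⊎_; inj₁; inj₂)
open import Data.Sum.Relation.Binary.Pointwise using (Pointwise; inj₁; inj₂)
open import Data.Unit.Base using (⊤; tt)
open import Data.Vec.Functional using () renaming (_∷_ to infixr 5 _∷ᶠ_)
open import Function.Base using (_∘_; id)
open import Function.Bundles using (_⇔_; mk⇔)
open import Level using (0ℓ)
open import Relation.Binary.Construct.Add.Extrema.NonStrict _≤_ using ([≤]-injective; ≤±-trans)
import Relation.Binary.Construct.Add.Infimum.NonStrict _≤_ as Inf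
import Relation.Binary.Construct.Add.Supremum.NonStrict Inf._≤₋_ as Sup
open import Relation.Binary.PropositionalEquality
  using (_≡_; _≢_; _≗_; refl; sym; trans; cong; cong₂; subst; subst₂; module ≡-Reasoning)
open import Relation.Nullary.Construct.Add.Extrema using (⊥±; ⊤±; [_])
open import Relation.Nullary.Decidable
  using (Dec; yes; no; does; does-⇔; _×-dec_; ¬?; dec-true; dec-false)
open import Relation.Nullary.Negation using (¬_; contradiction)
open import Relation.Unary using (Pred; Decidable)

open SemiringSum ℕ.+-*-semiring
  using (sum; sum-syntax; sum-cong-≗; sum-replicate-zero; ∑-distrib-+; *-distribˡ-sum; *-distribʳ-sum)
open RawMonoidDefs (RawRing.+-rawMonoid +-*-rawRing) using () renaming (_×_ to _·ℤ_)
open RawMonoidDefs (RawRing.+-rawMonoid polyRawRing) using () renaming (_×_ to _·ₚ_)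
open IsTwoLevel

-- Homomorphisms are counted by fixing the image of the first vertex. For a star
-- it is the centre; for K_q, the remaining vertices then form a clique inside a
-- neighbourhood of K_a ⊔ K_b, and such a neighbourhood is complete.
--
-- For (2), the coefficient of x^(2q - 2k) in (x²)_q satisfies the Stirling
-- recursion a_k(q + 1) = a_k(q) - q a_(k-1)(q), so it is a polynomial in q, by
-- summation in the basis of binomial coefficients. In both parts the lower-order
-- summand has degree g(q) - e(q) - 1, so it first contributes one step past the
-- claimed depth e(q), where it breaks the agreement with the polynomial φ_r.

-- Counting homomorphisms

-- A value at one q says nothing about `φ r`, because some polynomial fits any finite set of data.
-- Exactness rests on the condition that the larger depth dominates e everywhere: this fixes `φ r`
-- at infinitely many arguments, so an excess at even a single q contradicts the identity of
-- polynomials. In (2) the recursion for a_k(q + 1) involves exponents outside the range of (x²)_q;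
-- the induction closes because the polynomial a_k vanishes at every natural q < k. Coefficient
-- lists may end in zeros, so identities between polynomials are proved for coefficients or for
-- values, not for lists.

private
  variable
    m n q : ℕ
    A B : Set

⟦_⟧ : Dec A → ℕ
⟦ a? ⟧ = if does a? then 1 else 0

⟦⟧-cong : A ⇔ B → (a? : Dec A) (b? : Dec B) → ⟦ a? ⟧ ≡ ⟦ b? ⟧
⟦⟧-cong A⇔B a? b? = cong (if_then 1 else 0) (does-⇔ A⇔B a? b?)

⟦⟧-yes : (a? : Dec A) → A → ⟦ a? ⟧ ≡ 1
⟦⟧-yes a? a = cong (if_then 1 else 0) (dec-true a? a)

⟦⟧-no : (a? : Dec A) → ¬ A → ⟦ a? ⟧ ≡ 0
⟦⟧-no a? ¬a = cong (if_then 1 else 0) (dec-false a? ¬a)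

⟦⟧-× : (a? : Dec A) (b? : Dec B) → ⟦ a? ×-dec b? ⟧ ≡ ⟦ a? ⟧ * ⟦ b? ⟧
⟦⟧-× (yes _) b? = sym (*-identityˡ _)
⟦⟧-× (no _)  b? = refl

sum-zero : (t : Fin n → ℕ) → (∀ i → t i ≡ 0) → sum t ≡ 0
sum-zero {n} t t≗0 = trans (sum-cong-≗ t≗0) (sum-replicate-zero n)

sum-const : ∀ n c → ∑[ i < n ] c ≡ n * c
sum-const zero    c = refl
sum-const (suc n) c = cong (_+_ c) (sum-const n c)

sum-+ : ∀ m (t : Fin (m + n) → ℕ) →
        sum t ≡ ∑[ i < m ] t (i ↑ˡ n) + ∑[ j < n ] t (m ↑ʳ j)
sum-+ zero    t = refl
sum-+ (suc m) t =
  trans (cong (_+_ (t zero)) (sum-+ m (t ∘ suc))) (sym (+-assoc (t zero) _ _))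

sum-* : ∀ m (t : Fin (m * n) → ℕ) →
        sum t ≡ ∑[ i < m ] ∑[ j < n ] t (combine i j)
sum-*     zero    t = refl
sum-* {n} (suc m) t =
  trans (sum-+ n t) (cong (_+_ (∑[ j < n ] t (j ↑ˡ (m * n)))) (sum-* m (t ∘ (n ↑ʳ_))))

length-filter-tabulate : {P : Pred A 0ℓ} (P? : Decidable P) (f : Fin n → A) →
  length (filter P? (tabulate f)) ≡ ∑[ i < n ] ⟦ P? (f i) ⟧
length-filter-tabulate {n = zero}  P? f = refl
length-filter-tabulate {n = suc n} P? f with P? (f zero)
... | yes _ = cong suc (length-filter-tabulate P? (f ∘ suc))
... | no  _ = length-filter-tabulate P? (f ∘ suc)

opaque
  -- Opaque, so that outside the blocks that unfold them counts are handled through their predicates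
  -- and not as sums over encoded maps.
  #_ : {P : Pred (Fin n) 0ℓ} → Decidable P → ℕ
  # P? = ∑[ i < _ ] ⟦ P? i ⟧

  #maps : {P : Pred (Fin q → Fin m) 0ℓ} → Decidable P → ℕ
  #maps {q} {m} P? = ∑[ k < m ^ q ] ⟦ P? (finToFun k) ⟧

opaque
  unfolding #_

  #-suc : {P : Pred (Fin (suc n)) 0ℓ} (P? : Decidable P) →
          # P? ≡ ⟦ P? zero ⟧ + # (P? ∘ suc)
  #-suc P? = refl

  #-+ : ∀ m {P : Pred (Fin (m + n)) 0ℓ} (P? : Decidable P) →
        # P? ≡ # (P? ∘ (_↑ˡ n)) + # (P? ∘ (m ↑ʳ_))
  #-+ m P? = sum-+ m λ i → ⟦ P? i ⟧

  #-* : {P : Pred (Fin n) 0ℓ} (P? : Decidable P) (c : ℕ) →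
        # P? * c ≡ ∑[ i < n ] (⟦ P? i ⟧ * c)
  #-* P? c = *-distribʳ-sum c λ i → ⟦ P? i ⟧

  #-cong : {P Q : Pred (Fin n) 0ℓ} (P? : Decidable P) (Q? : Decidable Q) →
           (∀ i → P i ⇔ Q i) → # P? ≡ # Q?
  #-cong P? Q? P⇔Q = sum-cong-≗ λ i → ⟦⟧-cong (P⇔Q i) (P? i) (Q? i)

  #-none : {P : Pred (Fin n) 0ℓ} (P? : Decidable P) → (∀ i → ¬ P i) → # P? ≡ 0
  #-none P? ¬P = sum-zero _ λ i → ⟦⟧-no (P? i) (¬P i)

  #-all : {P : Pred (Fin n) 0ℓ} (P? : Decidable P) → (∀ i → P i) → # P? ≡ n
  #-all {n} P? p =
    trans (sum-cong-≗ λ i → ⟦⟧-yes (P? i) (p i)) (trans (sum-const n 1) (*-identityʳ n))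

#-singleton : (i : Fin n) → # (i ≟_) ≡ 1
#-singleton zero    = trans (#-suc (zero ≟_)) (cong suc (#-none (λ j → zero ≟ suc j) λ _ ()))
#-singleton (suc i) = trans (#-suc (suc i ≟_))
  (trans (#-cong (λ j → suc i ≟ suc j) (i ≟_) (λ j → mk⇔ Fin.suc-injective (cong suc)))
         (#-singleton i))

-- The leading digit of a code is the image of vertex `zero`; this lets `#maps-suc` sum over that
-- image.
finToFun-combine : (i : Fin m) (k : Fin (m ^ q)) → finToFun {m} {suc q} (combine i k) ≗ (i ∷ᶠ finToFun k)
finToFun-combine i k zero    = cong proj₁ (remQuot-combine i k)
finToFun-combine i k (suc u) = cong (λ r → finToFun (proj₂ r) u) (remQuot-combine i k)

-- Decoding `combine i k` gives `i ∷ᶠ finToFun k` only pointwise, so a predicate can be carried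
-- along it only if it respects pointwise equality.
Extensional : Pred (Fin q → Fin m) 0ℓ → Set
Extensional P = ∀ {f g} → f ≗ g → P f → P g

opaque
  unfolding #_ #maps

  -- In a complete set the neighbours of i are the other elements. This yields both the degrees in
  -- `K a` and the drop from m to m - 1 in the falling factorial.
  #-remove : {P : Pred (Fin n) 0ℓ} (P? : Decidable P) {i : Fin n} → P i →
             # P? ≡ suc (# (λ j → P? j ×-dec ¬? (i ≟ j)))
  #-remove {n} P? {i} Pi = begin
    # P?
      ≡⟨ sum-cong-≗ split ⟩
    ∑[ j < n ] (⟦ i ≟ j ⟧ + ⟦ P? j ×-dec ¬? (i ≟ j) ⟧)
      ≡⟨ ∑-distrib-+ _ (λ j → ⟦ P? j ×-dec ¬? (i ≟ j) ⟧) ⟩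
    # (i ≟_) + # (λ j → P? j ×-dec ¬? (i ≟ j))
      ≡⟨ cong (_+ # (λ j → P? j ×-dec ¬? (i ≟ j))) (#-singleton i) ⟩
    suc (# (λ j → P? j ×-dec ¬? (i ≟ j))) ∎
    where
    open ≡-Reasoning
    split : ∀ j → ⟦ P? j ⟧ ≡ ⟦ i ≟ j ⟧ + ⟦ P? j ×-dec ¬? (i ≟ j) ⟧
    split j with i ≟ j
    ... | yes refl = trans (⟦⟧-yes (P? i) Pi)
                           (cong suc (sym (⟦⟧-no (P? i ×-dec ¬? (yes (refl {x = i}))) λ (_ , i≢i) → i≢i refl)))
    ... | no i≢j = ⟦⟧-cong (mk⇔ (λ p → p , i≢j) proj₁) (P? j) (P? j ×-dec yes i≢j)

  hom≡#maps : ∀ F G → hom F G ≡ #maps (isHom? F G)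
  hom≡#maps F G = length-filter-tabulate (λ i → isHom? F G (finToFun i)) id

  #maps-cong : {P Q : Pred (Fin q → Fin m) 0ℓ} (P? : Decidable P) (Q? : Decidable Q) →
               (∀ f → P f ⇔ Q f) → #maps P? ≡ #maps Q?
  #maps-cong {q} {m} P? Q? P⇔Q =
    sum-cong-≗ {m ^ q} λ k → ⟦⟧-cong (P⇔Q (finToFun k)) (P? (finToFun k)) (Q? (finToFun k))

  #maps-× : {P : Pred (Fin q → Fin m) 0ℓ} (a? : Dec A) (P? : Decidable P) →
            #maps (λ f → a? ×-dec P? f) ≡ ⟦ a? ⟧ * #maps P?
  #maps-× a? P? =
    trans (sum-cong-≗ λ k → ⟦⟧-× a? (P? (finToFun k)))
          (sym (*-distribˡ-sum ⟦ a? ⟧ λ k → ⟦ P? (finToFun k) ⟧))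

  #maps-suc : {P : Pred (Fin (suc q) → Fin m) 0ℓ} (P? : Decidable P) → Extensional P →
              #maps P? ≡ ∑[ i < m ] #maps (λ f → P? (i ∷ᶠ f))
  #maps-suc {q} {m} P? ext = trans (sum-* m _) (sum-cong-≗ λ i → sum-cong-≗ λ k →
    ⟦⟧-cong (mk⇔ (ext (finToFun-combine i k)) (ext (sym ∘ finToFun-combine i k)))
            (P? (finToFun (combine i k))) (P? (i ∷ᶠ finToFun k)))

  #maps-zero : {P : Pred (Fin 0 → Fin m) 0ℓ} (P? : Decidable P) → (∀ f → P f) → #maps P? ≡ 1
  #maps-zero P? p = cong (_+ 0) (⟦⟧-yes (P? _) (p _))

-- The q images are chosen independently, each in `# P?` ways.
#maps-into : ∀ q {P : Pred (Fin m) 0ℓ} (P? : Decidable P) →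
             #maps {q} (λ f → all? (P? ∘ f)) ≡ (# P?) ^ q
#maps-into         zero    P? = #maps-zero (λ f → all? (P? ∘ f)) λ _ ()
#maps-into {m = m} (suc q) {P} P? = begin
  #maps {suc q} (λ f → all? (P? ∘ f))
    ≡⟨ #maps-suc {q} (λ f → all? (P? ∘ f)) (λ f≗g p u → subst P (f≗g u) (p u)) ⟩
  ∑[ i < m ] #maps {q} (λ f → all? (P? ∘ (i ∷ᶠ f)))
    ≡⟨ sum-cong-≗ (λ i → #maps-cong {q} _ (λ f → P? i ×-dec all? (P? ∘ f)) (λ f →
         mk⇔ (λ p → p zero , p ∘ suc) λ { (p , ps) zero → p ; (p , ps) (suc u) → ps u })) ⟩
  ∑[ i < m ] #maps {q} (λ f → P? i ×-dec all? (P? ∘ f))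
    ≡⟨ sum-cong-≗ (λ i → trans (#maps-× (P? i) (λ f → all? (P? ∘ f)))
                               (cong (⟦ P? i ⟧ *_) (#maps-into q P?))) ⟩
  ∑[ i < m ] (⟦ P? i ⟧ * (# P?) ^ q)
    ≡⟨ #-* P? ((# P?) ^ q) ⟨
  (# P?) ^ suc q ∎
  where open ≡-Reasoning

-- Homomorphisms between stars

IsHom-ext : ∀ F G → Extensional (IsHom F G)
IsHom-ext F G f≗g h u v uv = subst₂ (Adj G) (f≗g u) (f≗g v) (h u v uv)

-- Once the centre is sent to i, the leaves go freely to neighbours of i, so the count is the sum of
-- deg(i)^(q + 1): the centre has degree n, and each of the n leaves has degree 1.
hom-S : ∀ q n → hom (S (suc q)) (S n) ≡ n ^ suc q + n
hom-S q n = begin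
  hom (S (suc q)) (S n)
    ≡⟨ hom≡#maps (S (suc q)) (S n) ⟩
  #maps (isHom? (S (suc q)) (S n))
    ≡⟨ #maps-suc {suc q} (isHom? (S (suc q)) (S n)) (IsHom-ext (S (suc q)) (S n)) ⟩
  ∑[ i < suc n ] #maps {suc q} (λ f → isHom? (S (suc q)) (S n) (i ∷ᶠ f))
    ≡⟨ sum-cong-≗ (λ i → trans (#maps-cong {suc q} (λ f → isHom? (S (suc q)) (S n) (i ∷ᶠ f))
                                                  (λ f → all? (adj? (S n) i ∘ f)) (centre-image i))
                               (#maps-into (suc q) (adj? (S n) i))) ⟩
  ∑[ i < suc n ] ((# adj? (S n) i) ^ suc q)
    ≡⟨ cong₂ _+_ (cong (_^ suc q) (trans (#-suc (adj? (S n) zero)) (#-all (λ i → adj? (S n) zero (suc i)) centre-leaf)))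
                 (trans (sum-cong-≗ λ i → cong (_^ suc q) (degree-leaf i)) (sum-const n (1 ^ suc q))) ⟩
  n ^ suc q + n * (1 ^ suc q)
    ≡⟨ cong (λ x → n ^ suc q + n * x) (^-zeroˡ (suc q)) ⟩
  n ^ suc q + n * 1
    ≡⟨ cong (_+_ (n ^ suc q)) (*-identityʳ n) ⟩
  n ^ suc q + n ∎
  where
  open ≡-Reasoning
  centre-image : ∀ i f → IsHom (S (suc q)) (S n) (i ∷ᶠ f) ⇔ (∀ u → Adj (S n) i (f u))
  centre-image i f = mk⇔ (λ h u → h zero (suc u) (centre-leaf u))
    λ { p zero (suc u) (centre-leaf u) → p u ; p (suc u) zero (leaf-centre u) → symm (S n) (p u) }
  degree-leaf : ∀ i → # adj? (S n) (suc i) ≡ 1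
  degree-leaf i = trans (#-suc (adj? (S n) (suc i))) (cong suc (#-none (λ j → adj? (S n) (suc i) (suc j)) λ _ ()))

-- Cliques in a disjoint union of two complete graphs

fallingℕ : ℕ → ℕ → ℕ
fallingℕ m zero    = 1
fallingℕ m (suc q) = m * fallingℕ (pred m) q

-- The induced subgraph on P is kept as a predicate on the vertices of G, so that passing to a
-- neighbourhood never changes the vertex type.
CliqueIn : (G : Graph) → Pred (Fin (order G)) 0ℓ → ∀ q → Pred (Fin q → Fin (order G)) 0ℓ
CliqueIn G P q f = IsHom (K q) G f × (∀ u → P (f u))

module _ (G : Graph) {P : Pred (Fin (order G)) 0ℓ} (P? : Decidable P) where

  cliqueIn? : ∀ q → Decidable (CliqueIn G P q)
  cliqueIn? q f = isHom? (K q) G f ×-dec all? (P? ∘ f)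

  CliqueIn-ext : ∀ q → Extensional (CliqueIn G P q)
  CliqueIn-ext q f≗g (h , p) = IsHom-ext (K q) G f≗g h , λ u → subst P (f≗g u) (p u)

CliqueIn-∷ᶠ : ∀ G {P : Pred (Fin (order G)) 0ℓ} i (f : Fin q → Fin (order G)) →
  CliqueIn G P (suc q) (i ∷ᶠ f) ⇔ (P i × CliqueIn G (λ j → P j × Adj G i j) q f)
CliqueIn-∷ᶠ G i f = mk⇔
  (λ (h , p) → p zero , (λ u v u≢v → h (suc u) (suc v) (u≢v ∘ Fin.suc-injective)) ,
               λ u → p (suc u) , h zero (suc u) λ ())
  λ (p , h , ps) →
    (λ { zero    zero    u≢v → contradiction refl u≢v
       ; zero    (suc v) _   → proj₂ (ps v)
       ; (suc u) zero    _   → symm G (proj₂ (ps u))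
       ; (suc u) (suc v) u≢v → h u v (u≢v ∘ cong suc) }) ,
    λ { zero → p ; (suc u) → proj₁ (ps u) }

#CliqueIn-suc : ∀ G {P : Pred (Fin (order G)) 0ℓ} (P? : Decidable P) q →
  #maps (cliqueIn? G P? (suc q)) ≡
  ∑[ i < order G ] (⟦ P? i ⟧ * #maps (cliqueIn? G (λ j → P? j ×-dec adj? G i j) q))
#CliqueIn-suc G P? q =
  trans (#maps-suc {q} (cliqueIn? G P? (suc q)) (CliqueIn-ext G P? (suc q)))
        (sum-cong-≗ λ i →
          trans (#maps-cong {q} _ (λ f → P? i ×-dec cliqueIn? G (λ j → P? j ×-dec adj? G i j) q f) (CliqueIn-∷ᶠ G i))
                (#maps-× {q} (P? i) (cliqueIn? G (λ j → P? j ×-dec adj? G i j) q)))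

-- Any first vertex i in P leaves the neighbours of i inside P. By completeness these are all of P
-- except i, again a complete set, with one element fewer.
#CliqueIn-complete : ∀ G {P : Pred (Fin (order G)) 0ℓ} (P? : Decidable P) q →
  (∀ {i j} → P i → P j → i ≢ j → Adj G i j) →
  #maps (cliqueIn? G P? q) ≡ fallingℕ (# P?) q
#CliqueIn-complete G P? zero    complete = #maps-zero (cliqueIn? G P? 0) λ _ → (λ ()) , λ ()
#CliqueIn-complete G {P} P? (suc q) complete = begin
  #maps (cliqueIn? G P? (suc q))
    ≡⟨ #CliqueIn-suc G P? q ⟩
  ∑[ i < order G ] (⟦ P? i ⟧ * #maps (cliqueIn? G (λ j → P? j ×-dec adj? G i j) q))
    ≡⟨ sum-cong-≗ step ⟩
  ∑[ i < order G ] (⟦ P? i ⟧ * fallingℕ (pred (# P?)) q)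
    ≡⟨ #-* P? (fallingℕ (pred (# P?)) q) ⟨
  fallingℕ (# P?) (suc q) ∎
  where
  open ≡-Reasoning
  step : ∀ i → ⟦ P? i ⟧ * #maps (cliqueIn? G (λ j → P? j ×-dec adj? G i j) q)
             ≡ ⟦ P? i ⟧ * fallingℕ (pred (# P?)) q
  step i with P? i
  ... | no _   = refl
  ... | yes Pi = cong (1 *_) (trans
    (#CliqueIn-complete G (λ j → P? j ×-dec adj? G i j) q λ (Pj , _) (Pk , _) → complete Pj Pk)
    (cong (λ x → fallingℕ x q) (sym (trans (cong pred (#-remove P? Pi))
      (#-cong (λ j → P? j ×-dec ¬? (i ≟ j)) (λ j → P? j ×-dec adj? G i j) λ j →
        mk⇔ (λ (Pj , i≢j) → Pj , complete Pi Pj i≢j)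
            (λ (Pj , i~j) → Pj , λ i≡j → irrefl G i≡j i~j))))))

-- `K a ⊔ K b` is in general not complete, so `#CliqueIn-complete` cannot be applied to it directly.
-- One step of the clique recursion, from the trivial predicate, leads to the neighbourhoods, where
-- it can.
hom-K-suc : ∀ q G → hom (K (suc q)) G ≡ ∑[ i < order G ] #maps (cliqueIn? G (adj? G i) q)
hom-K-suc q G = begin
  hom (K (suc q)) G
    ≡⟨ hom≡#maps (K (suc q)) G ⟩
  #maps (isHom? (K (suc q)) G)
    ≡⟨ #maps-cong {suc q} _ (cliqueIn? G ⊤? (suc q)) (λ f → mk⇔ (λ h → h , _) proj₁) ⟩
  #maps (cliqueIn? G ⊤? (suc q))
    ≡⟨ #CliqueIn-suc G ⊤? q ⟩
  ∑[ i < order G ] (1 * #maps (cliqueIn? G (λ j → ⊤? j ×-dec adj? G i j) q))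
    ≡⟨ sum-cong-≗ (λ i → trans (*-identityˡ (#maps (cliqueIn? G (λ j → ⊤? j ×-dec adj? G i j) q)))
         (#maps-cong {q} _ (cliqueIn? G (adj? G i) q) λ f →
         mk⇔ (λ (h , p) → h , proj₂ ∘ p) (λ (h , p) → h , λ u → tt , p u))) ⟩
  ∑[ i < order G ] #maps (cliqueIn? G (adj? G i) q) ∎
  where
  open ≡-Reasoning
  ⊤? : Decidable {A = Fin (order G)} (λ _ → ⊤)
  ⊤? _ = yes tt

module _ (a b : ℕ) where

  private
    G : Graph
    G = K a ⊔ K b

  degree-left : ∀ i → # adj? G (i ↑ˡ b) ≡ pred a
  degree-left i = begin
    # adj? G (i ↑ˡ b)
      ≡⟨ #-+ a (adj? G (i ↑ˡ b)) ⟩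
    # (λ j → adj? G (i ↑ˡ b) (j ↑ˡ b)) + # (λ j → adj? G (i ↑ˡ b) (a ↑ʳ j))
      ≡⟨ cong₂ _+_
           (#-cong (λ j → adj? G (i ↑ˡ b) (j ↑ˡ b)) (λ j → yes tt ×-dec ¬? (i ≟ j))
                   (λ j → mk⇔ (λ r → tt , to j r) (from j ∘ proj₂)))
           (#-none (λ j → adj? G (i ↑ˡ b) (a ↑ʳ j)) cross) ⟩
    # (λ j → yes tt ×-dec ¬? (i ≟ j)) + 0
      ≡⟨ +-identityʳ _ ⟩
    # (λ j → yes tt ×-dec ¬? (i ≟ j))
      ≡⟨ cong pred (trans (sym (#-remove (λ _ → yes tt) tt)) (#-all {n = a} (λ _ → yes tt) (λ _ → tt))) ⟩
    pred a ∎
    where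
    open ≡-Reasoning
    to : ∀ j → Adj G (i ↑ˡ b) (j ↑ˡ b) → i ≢ j
    to j r rewrite splitAt-↑ˡ a i b | splitAt-↑ˡ a j b with inj₁ i≢j ← r = i≢j
    from : ∀ j → i ≢ j → Adj G (i ↑ˡ b) (j ↑ˡ b)
    from j i≢j rewrite splitAt-↑ˡ a i b | splitAt-↑ˡ a j b = inj₁ i≢j
    cross : ∀ j → ¬ Adj G (i ↑ˡ b) (a ↑ʳ j)
    cross j r rewrite splitAt-↑ˡ a i b | splitAt-↑ʳ a b j with () ← r

  degree-right : ∀ i → # adj? G (a ↑ʳ i) ≡ pred b
  degree-right i = begin
    # adj? G (a ↑ʳ i)
      ≡⟨ #-+ a (adj? G (a ↑ʳ i)) ⟩
    # (λ j → adj? G (a ↑ʳ i) (j ↑ˡ b)) + # (λ j → adj? G (a ↑ʳ i) (a ↑ʳ j))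
      ≡⟨ cong₂ _+_
           (#-none (λ j → adj? G (a ↑ʳ i) (j ↑ˡ b)) cross)
           (#-cong (λ j → adj? G (a ↑ʳ i) (a ↑ʳ j)) (λ j → yes tt ×-dec ¬? (i ≟ j))
                   (λ j → mk⇔ (λ r → tt , to j r) (from j ∘ proj₂))) ⟩
    # (λ j → yes tt ×-dec ¬? (i ≟ j))
      ≡⟨ cong pred (trans (sym (#-remove (λ _ → yes tt) tt)) (#-all {n = b} (λ _ → yes tt) (λ _ → tt))) ⟩
    pred b ∎
    where
    open ≡-Reasoning
    to : ∀ j → Adj G (a ↑ʳ i) (a ↑ʳ j) → i ≢ j
    to j r rewrite splitAt-↑ʳ a b i | splitAt-↑ʳ a b j with inj₂ i≢j ← r = i≢j
    from : ∀ j → i ≢ j → Adj G (a ↑ʳ i) (a ↑ʳ j)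
    from j i≢j rewrite splitAt-↑ʳ a b i | splitAt-↑ʳ a b j = inj₂ i≢j
    cross : ∀ j → ¬ Adj G (a ↑ʳ i) (j ↑ˡ b)
    cross j r rewrite splitAt-↑ʳ a b i | splitAt-↑ˡ a j b with () ← r

  -- Two neighbours of i lie in the same summand as i, where distinct vertices are adjacent.
  -- Distinctness passes through `splitAt` because `join` inverts it.
  neighbours-complete : ∀ {i j k} → Adj G i j → Adj G i k → j ≢ k → Adj G j k
  neighbours-complete {i} {j} {k} ij ik j≢k =
    joined (splitAt a i) (splitAt a j) (splitAt a k) ij ik λ eq →
      j≢k (trans (sym (join-splitAt a b j)) (trans (cong (join a b) eq) (join-splitAt a b k)))
    where
    joined : ∀ x y z → Pointwise _≢_ _≢_ x y → Pointwise _≢_ _≢_ x z → y ≢ z → Pointwise _≢_ _≢_ y z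
    joined _ _ _ (inj₁ _) (inj₁ _) y≢z = inj₁ (y≢z ∘ cong inj₁)
    joined _ _ _ (inj₂ _) (inj₂ _) y≢z = inj₂ (y≢z ∘ cong inj₂)

  -- Each of the a vertices on the left contributes (a - 1)_q, which gives a (a - 1)_q = (a)_(q +
  -- 1), and likewise on the right. The source needs a vertex: for the empty graph there is one map,
  -- but the two falling factorials add up to 2.
  hom-K : ∀ q → hom (K (suc q)) G ≡ fallingℕ a (suc q) + fallingℕ b (suc q)
  hom-K q = begin
    hom (K (suc q)) G
      ≡⟨ hom-K-suc q G ⟩
    ∑[ i < a + b ] #maps (cliqueIn? G (adj? G i) q)
      ≡⟨ sum-cong-≗ (λ i → #CliqueIn-complete G (adj? G i) q (neighbours-complete {i})) ⟩
    ∑[ i < a + b ] fallingℕ (# adj? G i) q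
      ≡⟨ sum-+ a _ ⟩
    ∑[ i < a ] fallingℕ (# adj? G (i ↑ˡ b)) q + ∑[ i < b ] fallingℕ (# adj? G (a ↑ʳ i)) q
      ≡⟨ cong₂ _+_
           (trans (sum-cong-≗ λ i → cong (λ d → fallingℕ d q) (degree-left i)) (sum-const a _))
           (trans (sum-cong-≗ λ i → cong (λ d → fallingℕ d q) (degree-right i)) (sum-const b _)) ⟩
    fallingℕ a (suc q) + fallingℕ b (suc q) ∎
    where open ≡-Reasoning

-- Falling factorials over ℕ and over ℤ

falling-head : ∀ x q → falling +-*-rawRing x (suc q) ≡ x ℤ.* falling +-*-rawRing (x ℤ.- ℤ.1ℤ) q
falling-head x zero    = solve 1 (λ x → con ℤ.1ℤ :* (x :+ con ℤ.0ℤ) := x :* con ℤ.1ℤ) refl x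
  where open ℤ-Solver
falling-head x (suc q) = trans (cong (ℤ._* (x ℤ.+ ℤ.- (suc q ·ℤ ℤ.1ℤ))) (falling-head x q))
  (solve 3 (λ x f k → (x :* f) :* (x :+ :- (con ℤ.1ℤ :+ k)) := x :* (f :* ((x :- con ℤ.1ℤ) :+ :- k)))
    refl x (falling +-*-rawRing (x ℤ.- ℤ.1ℤ) q) (q ·ℤ ℤ.1ℤ))
  where open ℤ-Solver

-- Counting splits off the first factor, `falling` the last one; `falling-head` reconciles them over
-- ℤ, where x - 1 is not truncated.
+-fallingℕ : ∀ m q → + fallingℕ m q ≡ falling +-*-rawRing (+ m) q
+-fallingℕ m       zero    = refl
-- The first factor is 0, so it does not matter that the remaining factors differ: `pred 0` is 0 on
-- one side, and the integer argument is -1 on the other.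
+-fallingℕ zero    (suc q) = sym (falling-head (+ 0) q)
+-fallingℕ (suc m) (suc q) = begin
  + (suc m * fallingℕ m q)                     ≡⟨ ℤ.pos-* (suc m) (fallingℕ m q) ⟩
  + suc m ℤ.* + fallingℕ m q                   ≡⟨ cong (+ suc m ℤ.*_) (+-fallingℕ m q) ⟩
  + suc m ℤ.* falling +-*-rawRing (+ m) q      ≡⟨ falling-head (+ suc m) q ⟨
  falling +-*-rawRing (+ suc m) (suc q)        ∎
  where open ≡-Reasoning

hom-S-S : ∀ q .{{_ : NonZero q}} n → hom (S q) (S n) ≡ n ^ q + n
hom-S-S (suc q) n = hom-S q n

hom-K-K⊔K : ∀ q .{{_ : NonZero q}} n →
  + hom (K q) (K (n ^ 2) ⊔ K n) ≡ falling +-*-rawRing (+ (n ^ 2)) q +ℤ falling +-*-rawRing (+ n) q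
hom-K-K⊔K (suc q) n = begin
  + hom (K (suc q)) (K (n ^ 2) ⊔ K n)
    ≡⟨ cong +_ (hom-K (n ^ 2) n q) ⟩
  + fallingℕ (n ^ 2) (suc q) +ℤ + fallingℕ n (suc q)
    ≡⟨ cong₂ _+ℤ_ (+-fallingℕ (n ^ 2) (suc q)) (+-fallingℕ n (suc q)) ⟩
  falling +-*-rawRing (+ (n ^ 2)) (suc q) +ℤ falling +-*-rawRing (+ n) (suc q) ∎
  where open ≡-Reasoning

-- Polynomials over ℚ

open ℚ-Solver using (solve; _:=_; _:+_; _:*_; :-_; con)

-- Division normalises by a gcd, which is stuck on a variable n; this form exposes the numerator.
fromℕ≡mkℚ : ∀ n → fromℕ n ≡ mkℚ (+ n) 0 (coprime-sym (1-coprimeTo n))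
fromℕ≡mkℚ n = ℚ.normalize-coprime (coprime-sym (1-coprimeTo n))

fromℕ-injective : ∀ {m n} → fromℕ m ≡ fromℕ n → m ≡ n
fromℕ-injective {m} {n} eq =
  ℤ.+-injective (cong ℚ.numerator (trans (sym (fromℕ≡mkℚ m)) (trans eq (fromℕ≡mkℚ n))))

fromℕ-+ : ∀ m n → fromℕ (m + n) ≡ fromℕ m +ℚ fromℕ n
fromℕ-+ m n = sym (trans (cong₂ _+ℚ_ (fromℕ≡mkℚ m) (fromℕ≡mkℚ n))
  (ℚ./-cong {q₁ = 1} (cong₂ ℤ._+_ (ℤ.*-identityʳ (+ m)) (ℤ.*-identityʳ (+ n))) refl))

fromℕ-suc-nonZero : ∀ n → ℚ.NonZero (fromℕ (suc n))
fromℕ-suc-nonZero n = ℚ.pos⇒nonZero (fromℕ (suc n)) {{ℚ.normalize-pos (suc n) 1}}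

1/suc : ℕ → ℚ
1/suc n = (1/ fromℕ (suc n)) {{fromℕ-suc-nonZero n}}

1/suc-inverseˡ : ∀ n → 1/suc n *ℚ fromℕ (suc n) ≡ 1ℚ
1/suc-inverseˡ n = ℚ.*-inverseˡ (fromℕ (suc n)) {{fromℕ-suc-nonZero n}}

fromℕ-suc-cancelˡ : ∀ n {y z} → fromℕ (suc n) *ℚ y ≡ fromℕ (suc n) *ℚ z → y ≡ z
fromℕ-suc-cancelˡ n {y} {z} eq = begin
  y                                    ≡⟨ unscale y ⟨
  1/suc n *ℚ (fromℕ (suc n) *ℚ y)      ≡⟨ cong (1/suc n *ℚ_) eq ⟩
  1/suc n *ℚ (fromℕ (suc n) *ℚ z)      ≡⟨ unscale z ⟩
  z                                    ∎
  where
  open ≡-Reasoning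
  unscale : ∀ y → 1/suc n *ℚ (fromℕ (suc n) *ℚ y) ≡ y
  unscale y = trans (sym (ℚ.*-assoc (1/suc n) (fromℕ (suc n)) y))
                    (trans (cong (_*ℚ y) (1/suc-inverseˡ n)) (ℚ.*-identityˡ y))

infixr 7 _∙ₚ_

_∙ₚ_ : ℚ → Poly → Poly
c ∙ₚ p = map (c *ℚ_) p

coeff-+ₚ : ∀ p s k → coeff (p +ₚ s) k ≡ coeff p k +ℚ coeff s k
coeff-+ₚ []      s       k       = sym (ℚ.+-identityˡ _)
coeff-+ₚ (a ∷ p) []      k       = sym (ℚ.+-identityʳ _)
coeff-+ₚ (a ∷ p) (b ∷ s) zero    = refl
coeff-+ₚ (a ∷ p) (b ∷ s) (suc k) = coeff-+ₚ p s k

coeff-∙ₚ : ∀ c p k → coeff (c ∙ₚ p) k ≡ c *ℚ coeff p k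
coeff-∙ₚ c []      k       = sym (ℚ.*-zeroʳ c)
coeff-∙ₚ c (a ∷ p) zero    = refl
coeff-∙ₚ c (a ∷ p) (suc k) = coeff-∙ₚ c p k

coeff-neg : ∀ p k → coeff (map -ℚ_ p) k ≡ -ℚ coeff p k
coeff-neg []      k       = refl
coeff-neg (a ∷ p) zero    = refl
coeff-neg (a ∷ p) (suc k) = coeff-neg p k

eval-+ₚ : ∀ p s x → eval (p +ₚ s) x ≡ eval p x +ℚ eval s x
eval-+ₚ []      s       x = sym (ℚ.+-identityˡ _)
eval-+ₚ (a ∷ p) []      x = sym (ℚ.+-identityʳ _)
eval-+ₚ (a ∷ p) (b ∷ s) x = trans (cong (λ y → (a +ℚ b) +ℚ x *ℚ y) (eval-+ₚ p s x))
  (solve 5 (λ a b x y z → (a :+ b) :+ x :* (y :+ z) := (a :+ x :* y) :+ (b :+ x :* z))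
    refl a b x (eval p x) (eval s x))

eval-∙ₚ : ∀ c p x → eval (c ∙ₚ p) x ≡ c *ℚ eval p x
eval-∙ₚ c []      x = sym (ℚ.*-zeroʳ c)
eval-∙ₚ c (a ∷ p) x = trans (cong (λ y → c *ℚ a +ℚ x *ℚ y) (eval-∙ₚ c p x))
  (solve 4 (λ c a x y → c :* a :+ x :* (c :* y) := c :* (a :+ x :* y)) refl c a x (eval p x))

-- Synthetic division: the Horner values at a of the successive tails. The quotient of `c ∷ p` by x
-- - a is `quotient a p`, and the remainder is the value at a.
quotient : ℚ → Poly → Poly
quotient a []      = []
quotient a (b ∷ p) = eval (b ∷ p) a ∷ quotient a p

length-quotient : ∀ a p → length (quotient a p) ≡ length p
length-quotient a []      = refl
length-quotient a (b ∷ p) = cong suc (length-quotient a p)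

eval-quotient : ∀ a c p x → eval (c ∷ p) x ≡ eval (c ∷ p) a +ℚ (x +ℚ -ℚ a) *ℚ eval (quotient a p) x
eval-quotient a c []      x =
  solve 3 (λ a c x → c :+ x :* con 0ℚ := (c :+ a :* con 0ℚ) :+ (x :+ :- a) :* con 0ℚ) refl a c x
eval-quotient a c (b ∷ p) x = trans (cong (λ y → c +ℚ x *ℚ y) (eval-quotient a b p x))
  (solve 5 (λ a c x e d → c :+ x :* (e :+ (x :+ :- a) :* d)
                       := (c :+ a :* e) :+ (x :+ :- a) :* (e :+ x :* d))
    refl a c x (eval (b ∷ p) a) (eval (quotient a p) x))

-- The root N is divided out, and the quotient vanishes at all later integers. The induction is on
-- length, since a quotient is not a sublist.
eval-vanishes : ∀ p N → (∀ k → eval p (fromℕ (N + k)) ≡ 0ℚ) → ∀ x → eval p x ≡ 0ℚ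
eval-vanishes []      N roots x = refl
eval-vanishes (c ∷ p) N roots x = by-length (length p) c p refl N roots x
  where
  by-length : ∀ n c p → length p ≡ n → ∀ N → (∀ k → eval (c ∷ p) (fromℕ (N + k)) ≡ 0ℚ) →
              ∀ x → eval (c ∷ p) x ≡ 0ℚ
  by-length n c [] len N roots x = trans (constant x (fromℕ (N + 0))) (roots 0)
    where
    constant : ∀ x y → eval (c ∷ []) x ≡ eval (c ∷ []) y
    constant = solve 3 (λ c x y → c :+ x :* con 0ℚ := c :+ y :* con 0ℚ) refl c
  by-length (suc n) c (b ∷ p) len N roots x = begin
    eval (c ∷ b ∷ p) x
      ≡⟨ eval-quotient a c (b ∷ p) x ⟩
    eval (c ∷ b ∷ p) a +ℚ (x +ℚ -ℚ a) *ℚ eval s x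
      ≡⟨ cong₂ (λ y z → y +ℚ (x +ℚ -ℚ a) *ℚ z) root (by-length n (eval (b ∷ p) a) (quotient a p) len′ (suc N) roots′ x) ⟩
    0ℚ +ℚ (x +ℚ -ℚ a) *ℚ 0ℚ
      ≡⟨ solve 1 (λ d → con 0ℚ :+ d :* con 0ℚ := con 0ℚ) refl (x +ℚ -ℚ a) ⟩
    0ℚ ∎
    where
    open ≡-Reasoning
    a = fromℕ N
    s = quotient a (b ∷ p)
    len′ = trans (length-quotient a p) (suc-injective len)
    root : eval (c ∷ b ∷ p) a ≡ 0ℚ
    root = subst (λ m → eval (c ∷ b ∷ p) (fromℕ m) ≡ 0ℚ) (+-identityʳ N) (roots 0)
    -- At N + 1 + k the linear factor equals k + 1, which is nonzero and cancels.
    roots′ : ∀ k → eval s (fromℕ (suc N + k)) ≡ 0ℚ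
    roots′ k = fromℕ-suc-cancelˡ k (begin
      fromℕ (suc k) *ℚ e
        ≡⟨ solve 3 (λ a d e → d :* e := con 0ℚ :+ ((a :+ d) :+ :- a) :* e) refl a (fromℕ (suc k)) e ⟩
      0ℚ +ℚ ((a +ℚ fromℕ (suc k)) +ℚ -ℚ a) *ℚ e
        ≡⟨ cong₂ (λ y z → y +ℚ (z +ℚ -ℚ a) *ℚ e) root (trans (cong fromℕ (sym (+-suc N k))) (fromℕ-+ N (suc k))) ⟨
      eval (c ∷ b ∷ p) a +ℚ (y +ℚ -ℚ a) *ℚ e
        ≡⟨ eval-quotient a c (b ∷ p) y ⟨
      eval (c ∷ b ∷ p) y
        ≡⟨ cong (λ m → eval (c ∷ b ∷ p) (fromℕ m)) (+-suc N k) ⟨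
      eval (c ∷ b ∷ p) (fromℕ (N + suc k))
        ≡⟨ roots (suc k) ⟩
      0ℚ
        ≡⟨ ℚ.*-zeroʳ (fromℕ (suc k)) ⟨
      fromℕ (suc k) *ℚ 0ℚ ∎)
      where
      y = fromℕ (suc N + k)
      e = eval s y

eval-unique : ∀ p s N → (∀ k → eval p (fromℕ (N + k)) ≡ eval s (fromℕ (N + k))) →
              ∀ x → eval p x ≡ eval s x
eval-unique p s N agrees x = begin
  eval p x                           ≡⟨ add-back (eval p x) (eval s x) ⟩
  difference x +ℚ eval s x           ≡⟨ cong (_+ℚ eval s x) (trans (sym (eval-difference x))
                                          (eval-vanishes (p +ₚ (-ℚ 1ℚ) ∙ₚ s) N difference-root x)) ⟩
  0ℚ +ℚ eval s x                     ≡⟨ ℚ.+-identityˡ (eval s x) ⟩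
  eval s x                           ∎
  where
  open ≡-Reasoning
  difference : ℚ → ℚ
  difference x = eval p x +ℚ -ℚ 1ℚ *ℚ eval s x
  eval-difference : ∀ x → eval (p +ₚ (-ℚ 1ℚ) ∙ₚ s) x ≡ difference x
  eval-difference x = trans (eval-+ₚ p _ x) (cong (eval p x +ℚ_) (eval-∙ₚ (-ℚ 1ℚ) s x))
  add-back : ∀ y z → y ≡ y +ℚ -ℚ 1ℚ *ℚ z +ℚ z
  add-back = solve 2 (λ y z → y := y :+ (:- con 1ℚ) :* z :+ z) refl
  cancel : ∀ y → y +ℚ -ℚ 1ℚ *ℚ y ≡ 0ℚ
  cancel = solve 1 (λ y → y :+ (:- con 1ℚ) :* y := con 0ℚ) refl
  difference-root : ∀ k → eval (p +ₚ (-ℚ 1ℚ) ∙ₚ s) (fromℕ (N + k)) ≡ 0ℚ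
  difference-root k = trans (eval-difference (fromℕ (N + k)))
    (trans (cong (_+ℚ -ℚ 1ℚ *ℚ eval s (fromℕ (N + k))) (agrees k)) (cancel (eval s (fromℕ (N + k)))))

-- Exactness of a depth function

topCoeff-≡ : ∀ p {d j r} → j + r ≡ d → topCoeff p d r ≡ coeff p j
topCoeff-≡ p {d} {j} {r} refl with r ≤? j + r
... | yes _  = cong (coeff p) (m+n∸n≡m j r)
... | no r≰d = contradiction (ℕ.m≤n+m r j) r≰d

[]≤⊖1⇒< : ∀ {r k} → [ r ] ≤± k ⊖1 → r < k
[]≤⊖1⇒< {k = zero}  Sup.[ () ]
[]≤⊖1⇒< {k = suc k} r≤k = s≤s ([≤]-injective r≤k)

<⇒[]≤⊖1 : ∀ {r k} → r < k → [ r ] ≤± k ⊖1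
<⇒[]≤⊖1 (s≤s r≤k) = Sup.[ Inf.[ r≤k ] ]

-- No depth lies strictly between k - 1 and k, also for k = 0, where k - 1 is the bottom element.
⊖1≤⇒≡⊎[]≤ : ∀ k {x} → k ⊖1 ≤± x → x ≡ k ⊖1 ⊎ [ k ] ≤± x
⊖1≤⇒≡⊎[]≤ k       {⊤±}    _ = inj₂ ([ k ] Sup.≤⊤⁺)
⊖1≤⇒≡⊎[]≤ zero    {⊥±}    _ = inj₁ refl
⊖1≤⇒≡⊎[]≤ zero    {[ x ]} _ = inj₂ Sup.[ Inf.[ z≤n ] ]
⊖1≤⇒≡⊎[]≤ (suc k) {⊥±}    Sup.[ () ]
⊖1≤⇒≡⊎[]≤ (suc k) {[ x ]} k≤x with ℕ.m≤n⇒m<n∨m≡n ([≤]-injective k≤x)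
... | inj₁ k<x  = inj₂ Sup.[ Inf.[ k<x ] ]
... | inj₂ refl = inj₁ refl

-- A valid depth exceeding h q - 1 at q would force the polynomials φ (h q) of
-- both depth functions to agree at all large arguments, hence also at q.
exactDepth : ∀ {f g} (h : ℕ → ℕ) (W : IsTwoLevel f g (λ q → h q ⊖1)) →
  (∀ q .{{_ : NonZero q}} k → h q < h (suc q + k)) →
  (∀ q .{{_ : NonZero q}} → topCoeff (f q) (deg W q) (h q) ≢ eval (φ W (h q)) (fromℕ q)) →
  IsTwoLevelOfExactDepth f g (λ q → h q ⊖1)
exactDepth {f} {g} h W h-increasing disagrees = W , maximal
  where
  maximal : ∀ e′ → IsTwoLevel f g e′ → (∀ q .{{_ : NonZero q}} → h q ⊖1 ≤± e′ q) →
            ∀ q .{{_ : NonZero q}} → e′ q ≡ h q ⊖1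
  maximal e′ W′ h≤e′ q with ⊖1≤⇒≡⊎[]≤ (h q) (h≤e′ q)
  ... | inj₁ eq   = eq
  ... | inj₂ r≤e′ = contradiction
    (trans (same-top q) (trans (agree W′ q (h q) r≤e′) (sym (same-φ (fromℕ q)))))
    (disagrees q)
    where
    -- Both degree functions give the values of `g` and hence coincide, so the two witnesses speak
    -- of the same coefficient.
    same-top : ∀ n .{{_ : NonZero n}} →
               topCoeff (f n) (deg W n) (h q) ≡ topCoeff (f n) (deg W′ n) (h q)
    same-top n = cong (λ d → topCoeff (f n) d (h q))
      (fromℕ-injective (trans (sym (g-values W n)) (g-values W′ n)))
    -- Beyond q, `h` exceeds `h q`, so the index `h q` is within both depths.
    same-φ : ∀ x → eval (φ W (h q)) x ≡ eval (φ W′ (h q)) x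
    same-φ = eval-unique (φ W (h q)) (φ W′ (h q)) (suc q) λ k →
      let n = suc q + k
          r≤ = <⇒[]≤⊖1 (h-increasing q k)
      in trans (sym (agree W n (h q) r≤))
           (trans (same-top n) (agree W′ n (h q) (≤±-trans ℕ.≤-trans r≤ (h≤e′ n))))

-- Coefficients of falling factorials of monomials

X^_ : ℕ → Poly
X^ zero  = 1ℚ ∷ []
X^ suc d = 0ℚ ∷ X^ d

shift : ℕ → Poly → Poly
shift zero    p = p
shift (suc d) p = 0ℚ ∷ shift d p

coeff-shift : ∀ d p k → coeff (shift d p) (d + k) ≡ coeff p k
coeff-shift zero    p k = refl
coeff-shift (suc d) p k = coeff-shift d p k

coeff-shift-[] : ∀ d k → coeff (shift d []) k ≡ 0ℚ
coeff-shift-[] zero    k       = refl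
coeff-shift-[] (suc d) zero    = refl
coeff-shift-[] (suc d) (suc k) = coeff-shift-[] d k

coeff-shift-∷ : ∀ d a p k →
  coeff (shift d (a ∷ p)) k ≡ a *ℚ coeff (X^ d) k +ℚ coeff (0ℚ ∷ shift d p) k
coeff-shift-∷ zero    a p zero    = solve 1 (λ a → a := a :* con 1ℚ :+ con 0ℚ) refl a
coeff-shift-∷ zero    a p (suc k) = solve 2 (λ a x → x := a :* con 0ℚ :+ x) refl a (coeff p k)
coeff-shift-∷ (suc d) a p zero    = solve 1 (λ a → con 0ℚ := a :* con 0ℚ :+ con 0ℚ) refl a
coeff-shift-∷ (suc d) a p (suc zero)    = coeff-shift-∷ d a p zero
coeff-shift-∷ (suc d) a p (suc (suc k)) = coeff-shift-∷ d a p (suc k)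

-- Multiplying by x^d + c adds c times the polynomial to its shift by d. The factor s is given by
-- its coefficients only, because the factors of `falling` have this shape only up to
-- representation.
coeff-*-binomial : ∀ d c s → (∀ k → coeff s k ≡ coeff (X^ d) k +ℚ coeff (c ∷ []) k) →
  ∀ p k → coeff (p *ₚ s) k ≡ c *ℚ coeff p k +ℚ coeff (shift d p) k
coeff-*-binomial d c s s≈ []      k =
  sym (trans (cong₂ _+ℚ_ (ℚ.*-zeroʳ c) (coeff-shift-[] d k)) (ℚ.+-identityˡ 0ℚ))
coeff-*-binomial d c s s≈ (a ∷ p) k = begin
  coeff (a ∙ₚ s +ₚ (0ℚ ∷ (p *ₚ s))) k
    ≡⟨ coeff-+ₚ (a ∙ₚ s) _ k ⟩
  coeff (a ∙ₚ s) k +ℚ coeff (0ℚ ∷ (p *ₚ s)) k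
    ≡⟨ cong (_+ℚ coeff (0ℚ ∷ (p *ₚ s)) k) (trans (coeff-∙ₚ a s k) (cong (a *ℚ_) (s≈ k))) ⟩
  a *ℚ (coeff (X^ d) k +ℚ coeff (c ∷ []) k) +ℚ coeff (0ℚ ∷ (p *ₚ s)) k
    ≡⟨ rest k ⟩
  c *ℚ coeff (a ∷ p) k +ℚ (a *ℚ coeff (X^ d) k +ℚ coeff (0ℚ ∷ shift d p) k)
    ≡⟨ cong (c *ℚ coeff (a ∷ p) k +ℚ_) (coeff-shift-∷ d a p k) ⟨
  c *ℚ coeff (a ∷ p) k +ℚ coeff (shift d (a ∷ p)) k ∎
  where
  open ≡-Reasoning
  rest : ∀ k → a *ℚ (coeff (X^ d) k +ℚ coeff (c ∷ []) k) +ℚ coeff (0ℚ ∷ (p *ₚ s)) k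
             ≡ c *ℚ coeff (a ∷ p) k +ℚ (a *ℚ coeff (X^ d) k +ℚ coeff (0ℚ ∷ shift d p) k)
  rest zero    = solve 3 (λ a c x → a :* (x :+ c) :+ con 0ℚ := c :* a :+ (a :* x :+ con 0ℚ))
    refl a c (coeff (X^ d) 0)
  rest (suc k) = trans (cong (a *ℚ (coeff (X^ d) (suc k) +ℚ 0ℚ) +ℚ_) (coeff-*-binomial d c s s≈ p k))
    (solve 5 (λ a c x y z → a :* (x :+ con 0ℚ) :+ (c :* y :+ z) := c :* y :+ (a :* x :+ z))
      refl a c (coeff (X^ d) (suc k)) (coeff p k) (coeff (shift d p) k))

coeff-X*ₚ : ∀ p k → coeff (X *ₚ p) k ≡ coeff (0ℚ ∷ p) k
coeff-X*ₚ p k = begin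
  coeff (X *ₚ p) k
    ≡⟨ coeff-+ₚ (0ℚ ∙ₚ p) _ k ⟩
  coeff (0ℚ ∙ₚ p) k +ℚ coeff (0ℚ ∷ (1ℚ ∙ₚ p +ₚ (0ℚ ∷ []))) k
    ≡⟨ cong (_+ℚ coeff (0ℚ ∷ (1ℚ ∙ₚ p +ₚ (0ℚ ∷ []))) k) (trans (coeff-∙ₚ 0ℚ p k) (ℚ.*-zeroˡ (coeff p k))) ⟩
  0ℚ +ℚ coeff (0ℚ ∷ (1ℚ ∙ₚ p +ₚ (0ℚ ∷ []))) k
    ≡⟨ ℚ.+-identityˡ _ ⟩
  coeff (0ℚ ∷ (1ℚ ∙ₚ p +ₚ (0ℚ ∷ []))) k
    ≡⟨ tail k ⟩
  coeff (0ℚ ∷ p) k ∎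
  where
  open ≡-Reasoning
  zeros : ∀ k → coeff (0ℚ ∷ []) k ≡ 0ℚ
  zeros = coeff-shift-[] 1
  tail : ∀ k → coeff (0ℚ ∷ (1ℚ ∙ₚ p +ₚ (0ℚ ∷ []))) k ≡ coeff (0ℚ ∷ p) k
  tail zero    = refl
  tail (suc k) = trans (coeff-+ₚ (1ℚ ∙ₚ p) (0ℚ ∷ []) k) (trans
    (cong₂ _+ℚ_ (trans (coeff-∙ₚ 1ℚ p k) (ℚ.*-identityˡ (coeff p k))) (zeros k)) (ℚ.+-identityʳ (coeff p k)))

coeff-X^ₚ : ∀ d k → coeff (X ^ₚ d) k ≡ coeff (X^ d) k
coeff-X^ₚ zero    k       = refl
coeff-X^ₚ (suc d) zero    = coeff-X*ₚ (X ^ₚ d) zero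
coeff-X^ₚ (suc d) (suc k) = trans (coeff-X*ₚ (X ^ₚ d) (suc k)) (coeff-X^ₚ d k)

coeff-X^-diag : ∀ d → coeff (X^ d) d ≡ 1ℚ
coeff-X^-diag zero    = refl
coeff-X^-diag (suc d) = coeff-X^-diag d

coeff-X^-off : ∀ d k → k ≢ d → coeff (X^ d) k ≡ 0ℚ
coeff-X^-off zero    zero    k≢d = contradiction refl k≢d
coeff-X^-off zero    (suc k) k≢d = refl
coeff-X^-off (suc d) zero    k≢d = refl
coeff-X^-off (suc d) (suc k) k≢d = coeff-X^-off d k (k≢d ∘ cong suc)

coeff-·ₚ : ∀ n k → coeff (n ·ₚ (1ℚ ∷ [])) k ≡ coeff (fromℕ n ∷ []) k
coeff-·ₚ zero    zero    = refl
coeff-·ₚ zero    (suc k) = refl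
coeff-·ₚ (suc n) k       = trans (coeff-+ₚ (1ℚ ∷ []) (n ·ₚ (1ℚ ∷ [])) k)
  (trans (cong (coeff (1ℚ ∷ []) k +ℚ_) (coeff-·ₚ n k)) (add k))
  where
  add : ∀ k → coeff (1ℚ ∷ []) k +ℚ coeff (fromℕ n ∷ []) k ≡ coeff (fromℕ (suc n) ∷ []) k
  add zero    = sym (fromℕ-+ 1 n)
  add (suc k) = refl

fallingX^ : ℕ → ℕ → Poly
fallingX^ d = falling polyRawRing (X ^ₚ d)

coeff-fallingX^-suc : ∀ d q k →
  coeff (fallingX^ d (suc q)) k ≡ -ℚ fromℕ q *ℚ coeff (fallingX^ d q) k +ℚ coeff (shift d (fallingX^ d q)) k
coeff-fallingX^-suc d q = coeff-*-binomial d (-ℚ fromℕ q) (X ^ₚ d +ₚ map -ℚ_ (q ·ₚ (1ℚ ∷ []))) (λ k →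
  trans (coeff-+ₚ (X ^ₚ d) _ k) (cong₂ _+ℚ_ (coeff-X^ₚ d k)
    (trans (coeff-neg (q ·ₚ (1ℚ ∷ [])) k) (trans (cong -ℚ_ (coeff-·ₚ q k)) (neg k))))) (fallingX^ d q)
  where
  neg : ∀ k → -ℚ coeff (fromℕ q ∷ []) k ≡ coeff (-ℚ fromℕ q ∷ []) k
  neg zero    = refl
  neg (suc k) = refl

module _ (d : ℕ) .{{_ : NonZero d}} where

  coeff-fallingX^-high : ∀ q k → coeff (fallingX^ d q) (suc (q * d + k)) ≡ 0ℚ
  coeff-fallingX^-high zero    k = refl
  coeff-fallingX^-high (suc q) k = begin
    coeff (fallingX^ d (suc q)) j
      ≡⟨ coeff-fallingX^-suc d q j ⟩
    -ℚ fromℕ q *ℚ coeff (fallingX^ d q) j +ℚ coeff (shift d (fallingX^ d q)) j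
      ≡⟨ cong₂ (λ x y → -ℚ fromℕ q *ℚ x +ℚ y)
           (trans (cong (coeff (fallingX^ d q)) j≡₁) (coeff-fallingX^-high q (d + k)))
           (trans (cong (coeff (shift d (fallingX^ d q))) j≡₂)
             (trans (coeff-shift d (fallingX^ d q) _) (coeff-fallingX^-high q k))) ⟩
    -ℚ fromℕ q *ℚ 0ℚ +ℚ 0ℚ
      ≡⟨ solve 1 (λ x → x :* con 0ℚ :+ con 0ℚ := con 0ℚ) refl (-ℚ fromℕ q) ⟩
    0ℚ ∎
    where
    open ≡-Reasoning
    j = suc (suc q * d + k)
    j≡₁ : j ≡ suc (q * d + (d + k))
    j≡₁ = cong suc (trans (cong (_+ k) (+-comm d (q * d))) (ℕ.+-assoc (q * d) d k))
    j≡₂ : j ≡ d + suc (q * d + k)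
    j≡₂ = trans (cong suc (ℕ.+-assoc d (q * d) k)) (sym (+-suc d (q * d + k)))

  coeff-fallingX^-> : ∀ {q k} → q * d < k → coeff (fallingX^ d q) k ≡ 0ℚ
  coeff-fallingX^-> {q} {k} qd<k =
    trans (cong (coeff (fallingX^ d q)) (sym (m+[n∸m]≡n qd<k))) (coeff-fallingX^-high q (k ∸ suc (q * d)))

  coeff-fallingX^-top : ∀ q → coeff (fallingX^ d q) (q * d) ≡ 1ℚ
  coeff-fallingX^-top zero    = refl
  coeff-fallingX^-top (suc q) = begin
    coeff (fallingX^ d (suc q)) (d + q * d)
      ≡⟨ coeff-fallingX^-suc d q _ ⟩
    -ℚ fromℕ q *ℚ coeff (fallingX^ d q) (d + q * d) +ℚ coeff (shift d (fallingX^ d q)) (d + q * d)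
      ≡⟨ cong₂ (λ x y → -ℚ fromℕ q *ℚ x +ℚ y) (coeff-fallingX^-> {q} (ℕ.m<n+m (q * d) (>-nonZero⁻¹ d)))
           (trans (coeff-shift d (fallingX^ d q) (q * d)) (coeff-fallingX^-top q)) ⟩
    -ℚ fromℕ q *ℚ 0ℚ +ℚ 1ℚ
      ≡⟨ solve 1 (λ x → x :* con 0ℚ :+ con 1ℚ := con 1ℚ) refl (-ℚ fromℕ q) ⟩
    1ℚ ∎
    where open ≡-Reasoning

-- The binomial basis and summation over q

binomial : ℕ → Poly
binomial zero    = 1ℚ ∷ []
binomial (suc i) = 1/suc i ∙ₚ ((0ℚ ∷ binomial i) +ₚ -ℚ fromℕ i ∙ₚ binomial i)

β : ℕ → ℕ → ℚ
β i q = eval (binomial i) (fromℕ q)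

β-zero : ∀ q → β 0 q ≡ 1ℚ
β-zero q = solve 1 (λ x → con 1ℚ :+ x :* con 0ℚ := con 1ℚ) refl (fromℕ q)

β-suc : ∀ i q → fromℕ (suc i) *ℚ β (suc i) q ≡ (fromℕ q +ℚ -ℚ fromℕ i) *ℚ β i q
β-suc i q = begin
  k *ℚ eval (1/suc i ∙ₚ p) x
    ≡⟨ cong (k *ℚ_) (eval-∙ₚ (1/suc i) p x) ⟩
  k *ℚ (1/suc i *ℚ eval p x)
    ≡⟨ solve 3 (λ k l e → k :* (l :* e) := (l :* k) :* e) refl k (1/suc i) (eval p x) ⟩
  (1/suc i *ℚ k) *ℚ eval p x
    ≡⟨ cong₂ _*ℚ_ (1/suc-inverseˡ i) (trans (eval-+ₚ (0ℚ ∷ binomial i) (-ℚ fromℕ i ∙ₚ binomial i) x)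
         (cong (0ℚ +ℚ x *ℚ β i q +ℚ_) (eval-∙ₚ (-ℚ fromℕ i) (binomial i) x))) ⟩
  1ℚ *ℚ (0ℚ +ℚ x *ℚ β i q +ℚ -ℚ fromℕ i *ℚ β i q)
    ≡⟨ solve 3 (λ x i b → con 1ℚ :* (con 0ℚ :+ x :* b :+ (:- i) :* b) := (x :+ :- i) :* b)
         refl x (fromℕ i) (β i q) ⟩
  (x +ℚ -ℚ fromℕ i) *ℚ β i q     ∎
  where
  open ≡-Reasoning
  k = fromℕ (suc i)
  x = fromℕ q
  p = (0ℚ ∷ binomial i) +ₚ -ℚ fromℕ i ∙ₚ binomial i

β-suc-zero : ∀ i → β (suc i) 0 ≡ 0ℚ
β-suc-zero i = fromℕ-suc-cancelˡ i (trans (β-suc i 0) (trans (vanish i) (sym (ℚ.*-zeroʳ (fromℕ (suc i))))))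
  where
  vanish : ∀ i → (0ℚ +ℚ -ℚ fromℕ i) *ℚ β i 0 ≡ 0ℚ
  vanish zero    = refl
  vanish (suc i) = trans (cong ((0ℚ +ℚ -ℚ fromℕ (suc i)) *ℚ_) (β-suc-zero i)) (ℚ.*-zeroʳ (0ℚ +ℚ -ℚ fromℕ (suc i)))

β-pascal : ∀ i q → β (suc i) (suc q) ≡ β (suc i) q +ℚ β i q
β-pascal zero q = fromℕ-suc-cancelˡ 0 (begin
  1ℚ *ℚ β 1 (suc q)
    ≡⟨ β-suc 0 (suc q) ⟩
  (fromℕ (suc q) +ℚ -ℚ 0ℚ) *ℚ β 0 (suc q)
    ≡⟨ cong₂ (λ x y → (x +ℚ -ℚ 0ℚ) *ℚ y) (fromℕ-+ 1 q) (β-zero (suc q)) ⟩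
  (1ℚ +ℚ fromℕ q +ℚ -ℚ 0ℚ) *ℚ 1ℚ
    ≡⟨ solve 1 (λ x → (con 1ℚ :+ x :+ :- con 0ℚ) :* con 1ℚ := (x :+ :- con 0ℚ) :* con 1ℚ :+ con 1ℚ) refl (fromℕ q) ⟩
  (fromℕ q +ℚ -ℚ 0ℚ) *ℚ 1ℚ +ℚ 1ℚ
    ≡⟨ cong (λ y → (fromℕ q +ℚ -ℚ 0ℚ) *ℚ y +ℚ y) (β-zero q) ⟨
  (fromℕ q +ℚ -ℚ 0ℚ) *ℚ β 0 q +ℚ β 0 q
    ≡⟨ cong (_+ℚ β 0 q) (β-suc 0 q) ⟨
  1ℚ *ℚ β 1 q +ℚ β 0 q
    ≡⟨ solve 2 (λ x y → con 1ℚ :* x :+ y := con 1ℚ :* (x :+ y)) refl (β 1 q) (β 0 q) ⟩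
  1ℚ *ℚ (β 1 q +ℚ β 0 q) ∎)
  where open ≡-Reasoning
β-pascal (suc i) q = fromℕ-suc-cancelˡ (suc i) (begin
  fromℕ (2 + i) *ℚ β (2 + i) (suc q)
    ≡⟨ β-suc (suc i) (suc q) ⟩
  (fromℕ (suc q) +ℚ -ℚ fromℕ (suc i)) *ℚ β (suc i) (suc q)
    ≡⟨ cong₂ (λ y z → (y +ℚ -ℚ fromℕ (suc i)) *ℚ z) (fromℕ-+ 1 q) (β-pascal i q) ⟩
  (1ℚ +ℚ x +ℚ -ℚ fromℕ (suc i)) *ℚ (b₁ +ℚ b₀)
    ≡⟨ cong (λ y → (1ℚ +ℚ x +ℚ -ℚ y) *ℚ (b₁ +ℚ b₀)) (fromℕ-+ 1 i) ⟩
  (1ℚ +ℚ x +ℚ -ℚ (1ℚ +ℚ fromℕ i)) *ℚ (b₁ +ℚ b₀)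
    ≡⟨ solve 4 (λ x i b₁ b₀ → (con 1ℚ :+ x :+ :- (con 1ℚ :+ i)) :* (b₁ :+ b₀)
                          := (x :+ :- i) :* b₁ :+ (x :+ :- i) :* b₀) refl x (fromℕ i) b₁ b₀ ⟩
  (x +ℚ -ℚ fromℕ i) *ℚ b₁ +ℚ (x +ℚ -ℚ fromℕ i) *ℚ b₀
    -- `β-suc` read backwards replaces (x - i) C(x, i) by (i + 1) C(x, i + 1), leaving only
    -- multiples of b₁ to regroup.
    ≡⟨ cong ((x +ℚ -ℚ fromℕ i) *ℚ b₁ +ℚ_) (trans (sym (β-suc i q)) (cong (_*ℚ b₁) (fromℕ-+ 1 i))) ⟩
  (x +ℚ -ℚ fromℕ i) *ℚ b₁ +ℚ (1ℚ +ℚ fromℕ i) *ℚ b₁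
    ≡⟨ solve 3 (λ x i b₁ → (x :+ :- i) :* b₁ :+ (con 1ℚ :+ i) :* b₁
                       := (x :+ :- (con 1ℚ :+ i)) :* b₁ :+ (con 1ℚ :+ (con 1ℚ :+ i)) :* b₁) refl x (fromℕ i) b₁ ⟩
  (x +ℚ -ℚ (1ℚ +ℚ fromℕ i)) *ℚ b₁ +ℚ (1ℚ +ℚ (1ℚ +ℚ fromℕ i)) *ℚ b₁
    ≡⟨ cong₂ (λ y z → (x +ℚ -ℚ y) *ℚ b₁ +ℚ z *ℚ b₁) (fromℕ-+ 1 i)
         (trans (fromℕ-+ 1 (suc i)) (cong (1ℚ +ℚ_) (fromℕ-+ 1 i))) ⟨
  (x +ℚ -ℚ fromℕ (suc i)) *ℚ b₁ +ℚ fromℕ (2 + i) *ℚ b₁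
    ≡⟨ cong (_+ℚ fromℕ (2 + i) *ℚ b₁) (β-suc (suc i) q) ⟨
  fromℕ (2 + i) *ℚ β (2 + i) q +ℚ fromℕ (2 + i) *ℚ b₁
    ≡⟨ ℚ.*-distribˡ-+ (fromℕ (2 + i)) (β (2 + i) q) b₁ ⟨
  fromℕ (2 + i) *ℚ (β (2 + i) q +ℚ b₁) ∎)
  where
  open ≡-Reasoning
  x  = fromℕ q
  b₁ = β (suc i) q
  b₀ = β i q

-- The starting index is an argument so that shifting every binomial is just a change of i.
fromBinomials : ℕ → List ℚ → Poly
fromBinomials i []       = []
fromBinomials i (b ∷ bs) = b ∙ₚ binomial i +ₚ fromBinomials (suc i) bs

⟪_,_⟫ : ℕ → List ℚ → ℕ → ℚ
⟪ i , bs ⟫ q = eval (fromBinomials i bs) (fromℕ q)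

⟪⟫-∷ : ∀ i b bs q → ⟪ i , b ∷ bs ⟫ q ≡ b *ℚ β i q +ℚ ⟪ suc i , bs ⟫ q
⟪⟫-∷ i b bs q = trans (eval-+ₚ (b ∙ₚ binomial i) (fromBinomials (suc i) bs) (fromℕ q))
  (cong (_+ℚ ⟪ suc i , bs ⟫ q) (eval-∙ₚ b (binomial i) (fromℕ q)))

-- Raising the starting index inverts the forward difference in q; together with the initial value
-- from `⟪⟫-suc-zero` it is summation over q.
⟪⟫-pascal : ∀ i bs q → ⟪ suc i , bs ⟫ (suc q) ≡ ⟪ suc i , bs ⟫ q +ℚ ⟪ i , bs ⟫ q
⟪⟫-pascal i []       q = refl
⟪⟫-pascal i (b ∷ bs) q = begin
  ⟪ suc i , b ∷ bs ⟫ (suc q)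
    ≡⟨ ⟪⟫-∷ (suc i) b bs (suc q) ⟩
  b *ℚ β (suc i) (suc q) +ℚ ⟪ 2 + i , bs ⟫ (suc q)
    ≡⟨ cong₂ (λ x y → b *ℚ x +ℚ y) (β-pascal i q) (⟪⟫-pascal (suc i) bs q) ⟩
  b *ℚ (β (suc i) q +ℚ β i q) +ℚ (⟪ 2 + i , bs ⟫ q +ℚ ⟪ suc i , bs ⟫ q)
    ≡⟨ solve 5 (λ b x y z w → b :* (x :+ y) :+ (z :+ w) := (b :* x :+ z) :+ (b :* y :+ w))
         refl b (β (suc i) q) (β i q) (⟪ 2 + i , bs ⟫ q) (⟪ suc i , bs ⟫ q) ⟩
  (b *ℚ β (suc i) q +ℚ ⟪ 2 + i , bs ⟫ q) +ℚ (b *ℚ β i q +ℚ ⟪ suc i , bs ⟫ q)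
    ≡⟨ cong₂ _+ℚ_ (⟪⟫-∷ (suc i) b bs q) (⟪⟫-∷ i b bs q) ⟨
  ⟪ suc i , b ∷ bs ⟫ q +ℚ ⟪ i , b ∷ bs ⟫ q ∎
  where open ≡-Reasoning

⟪⟫-suc-zero : ∀ i bs → ⟪ suc i , bs ⟫ 0 ≡ 0ℚ
⟪⟫-suc-zero i []       = refl
⟪⟫-suc-zero i (b ∷ bs) = trans (⟪⟫-∷ (suc i) b bs 0)
  (trans (cong₂ (λ x y → b *ℚ x +ℚ y) (β-suc-zero i) (⟪⟫-suc-zero (suc i) bs))
         (solve 1 (λ b → b :* con 0ℚ :+ con 0ℚ := con 0ℚ) refl b))

⟪⟫-∙ₚ : ∀ i c bs q → ⟪ i , c ∙ₚ bs ⟫ q ≡ c *ℚ ⟪ i , bs ⟫ q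
⟪⟫-∙ₚ i c []       q = sym (ℚ.*-zeroʳ c)
⟪⟫-∙ₚ i c (b ∷ bs) q = trans (⟪⟫-∷ i (c *ℚ b) (c ∙ₚ bs) q)
  (trans (cong (c *ℚ b *ℚ β i q +ℚ_) (⟪⟫-∙ₚ (suc i) c bs q))
    (trans (solve 4 (λ c b x y → c :* b :* x :+ c :* y := c :* (b :* x :+ y))
             refl c b (β i q) (⟪ suc i , bs ⟫ q))
           (cong (c *ℚ_) (sym (⟪⟫-∷ i b bs q)))))

-- Multiplication by q in the binomial basis, from
-- q C(q, i) = i C(q, i) + (i + 1) C(q, i + 1); c is the carry into index i.
multiply : ℕ → ℚ → List ℚ → List ℚ
multiply i c []       = c ∷ []
multiply i c (b ∷ bs) = (c +ℚ fromℕ i *ℚ b) ∷ multiply (suc i) (fromℕ (suc i) *ℚ b) bs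

⟪⟫-multiply : ∀ i c bs q → ⟪ i , multiply i c bs ⟫ q ≡ c *ℚ β i q +ℚ fromℕ q *ℚ ⟪ i , bs ⟫ q
⟪⟫-multiply i c []       q = trans (⟪⟫-∷ i c [] q)
  (cong (c *ℚ β i q +ℚ_) (sym (ℚ.*-zeroʳ (fromℕ q))))
⟪⟫-multiply i c (b ∷ bs) q = begin
  ⟪ i , multiply i c (b ∷ bs) ⟫ q
    ≡⟨ ⟪⟫-∷ i (c +ℚ k *ℚ b) (multiply (suc i) (k′ *ℚ b) bs) q ⟩
  (c +ℚ k *ℚ b) *ℚ β i q +ℚ ⟪ suc i , multiply (suc i) (k′ *ℚ b) bs ⟫ q
    ≡⟨ cong ((c +ℚ k *ℚ b) *ℚ β i q +ℚ_) (⟪⟫-multiply (suc i) (k′ *ℚ b) bs q) ⟩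
  (c +ℚ k *ℚ b) *ℚ β i q +ℚ (k′ *ℚ b *ℚ β (suc i) q +ℚ x *ℚ r)
    ≡⟨ solve 8 (λ c k b y k′ z x r → (c :+ k :* b) :* y :+ (k′ :* b :* z :+ x :* r)
                                  := (c :+ k :* b) :* y :+ (b :* (k′ :* z) :+ x :* r))
         refl c k b (β i q) k′ (β (suc i) q) x r ⟩
  (c +ℚ k *ℚ b) *ℚ β i q +ℚ (b *ℚ (k′ *ℚ β (suc i) q) +ℚ x *ℚ r)
    ≡⟨ cong (λ y → (c +ℚ k *ℚ b) *ℚ β i q +ℚ (b *ℚ y +ℚ x *ℚ r)) (β-suc i q) ⟩
  (c +ℚ k *ℚ b) *ℚ β i q +ℚ (b *ℚ ((x +ℚ -ℚ k) *ℚ β i q) +ℚ x *ℚ r)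
    ≡⟨ solve 6 (λ c k b y x r → (c :+ k :* b) :* y :+ (b :* ((x :+ :- k) :* y) :+ x :* r)
                             := c :* y :+ x :* (b :* y :+ r))
         refl c k b (β i q) x r ⟩
  c *ℚ β i q +ℚ x *ℚ (b *ℚ β i q +ℚ r)
    ≡⟨ cong (λ y → c *ℚ β i q +ℚ x *ℚ y) (⟪⟫-∷ i b bs q) ⟨
  c *ℚ β i q +ℚ x *ℚ ⟪ i , b ∷ bs ⟫ q ∎
  where
  open ≡-Reasoning
  k  = fromℕ i
  k′ = fromℕ (suc i)
  x  = fromℕ q
  r  = ⟪ suc i , bs ⟫ q

-- The coefficient of x^(2q - r) in (x²)_q as a polynomial in q, in the binomial
-- basis. A leading 0 shifts C(q, i) to C(q, i + 1), which by Pascal's rule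
-- sums over q, so the last clause solves a(q + 1) - a(q) = - q b(q), a(0) = 0.
stirling : ℕ → List ℚ
stirling 0             = 1ℚ ∷ []
stirling 1             = []
stirling (suc (suc r)) = 0ℚ ∷ multiply 0 0ℚ ((-ℚ 1ℚ) ∙ₚ stirling r)

stirlingₚ : ℕ → Poly
stirlingₚ r = fromBinomials 0 (stirling r)

σ : ℕ → ℕ → ℚ
σ r q = eval (stirlingₚ r) (fromℕ q)

σ-0 : ∀ q → σ 0 q ≡ 1ℚ
σ-0 q = solve 1 (λ x → con 1ℚ :* con 1ℚ :+ x :* con 0ℚ := con 1ℚ) refl (fromℕ q)

σ-shift : ∀ r q → σ (2 + r) q ≡ ⟪ 1 , multiply 0 0ℚ ((-ℚ 1ℚ) ∙ₚ stirling r) ⟫ q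
σ-shift r q = trans (⟪⟫-∷ 0 0ℚ bs q)
  (solve 2 (λ x y → con 0ℚ :* x :+ y := y) refl (β 0 q) (⟪ 1 , bs ⟫ q))
  where bs = multiply 0 0ℚ ((-ℚ 1ℚ) ∙ₚ stirling r)

-- By Pascal's rule the difference in q is the list without its leading 0, which `multiply` makes -q
-- times `σ r q`. The terms are arranged as in `coeff-fallingX^-suc`.
σ-suc : ∀ r q → σ (2 + r) (suc q) ≡ -ℚ fromℕ q *ℚ σ r q +ℚ σ (2 + r) q
σ-suc r q = begin
  σ (2 + r) (suc q)
    ≡⟨ σ-shift r (suc q) ⟩
  ⟪ 1 , bs ⟫ (suc q)
    ≡⟨ ⟪⟫-pascal 0 bs q ⟩
  ⟪ 1 , bs ⟫ q +ℚ ⟪ 0 , bs ⟫ q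
    ≡⟨ cong₂ _+ℚ_ (sym (σ-shift r q)) (trans (⟪⟫-multiply 0 0ℚ ((-ℚ 1ℚ) ∙ₚ stirling r) q)
         (cong (λ y → 0ℚ *ℚ β 0 q +ℚ fromℕ q *ℚ y) (⟪⟫-∙ₚ 0 (-ℚ 1ℚ) (stirling r) q))) ⟩
  σ (2 + r) q +ℚ (0ℚ *ℚ β 0 q +ℚ fromℕ q *ℚ (-ℚ 1ℚ *ℚ σ r q))
    ≡⟨ solve 4 (λ s b x t → s :+ (con 0ℚ :* b :+ x :* ((:- con 1ℚ) :* t)) := (:- x) :* t :+ s)
         refl (σ (2 + r) q) (β 0 q) (fromℕ q) (σ r q) ⟩
  -ℚ fromℕ q *ℚ σ r q +ℚ σ (2 + r) q ∎
  where
  open ≡-Reasoning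
  bs = multiply 0 0ℚ ((-ℚ 1ℚ) ∙ₚ stirling r)

-- For r > 2q the exponent 2q - r is negative, and the polynomial must give 0 there for the
-- recursion to hold at x^0 and x^1, which the shift by 2 does not reach.
σ-vanishes : ∀ {r q} → q * 2 < r → σ r q ≡ 0ℚ
σ-vanishes {1}                     _                 = refl
σ-vanishes {suc (suc r)} {zero}  _                 =
  trans (σ-shift r 0) (⟪⟫-suc-zero 0 (multiply 0 0ℚ ((-ℚ 1ℚ) ∙ₚ stirling r)))
σ-vanishes {suc (suc r)} {suc q} (s≤s (s≤s 2q<r)) = trans (σ-suc r q)
  (trans (cong₂ (λ x y → -ℚ fromℕ q *ℚ x +ℚ y) (σ-vanishes {r} {q} 2q<r)
           (σ-vanishes {2 + r} {q} (ℕ.m≤n⇒m≤o+n 2 2q<r)))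
         (solve 1 (λ x → x :* con 0ℚ :+ con 0ℚ := con 0ℚ) refl (-ℚ fromℕ q)))

-- If j + r = 2(q + 1), then in (x²)_q the exponent j lies r - 2 below the top and j - 2 lies r
-- below it, so the recursion for coefficients becomes `σ-suc`. The case split isolates j < 2 and r
-- < 2, where a term leaves the range.
coeff-fallingX² : ∀ q j r → j + r ≡ q * 2 → coeff (fallingX^ 2 q) j ≡ σ r q
coeff-fallingX² zero    zero zero eq = refl
coeff-fallingX² (suc q) j    r    eq = trans (coeff-fallingX^-suc 2 q j) (step j r eq)
  where
  Step : ℕ → ℕ → Set
  Step j r = -ℚ fromℕ q *ℚ coeff (fallingX^ 2 q) j +ℚ coeff (shift 2 (fallingX^ 2 q)) j ≡ σ r (suc q)

  add-terms : ∀ {j r} x y → coeff (fallingX^ 2 q) j ≡ x → coeff (shift 2 (fallingX^ 2 q)) j ≡ y →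
            -ℚ fromℕ q *ℚ x +ℚ y ≡ σ r (suc q) → Step j r
  add-terms x y refl refl eq = eq

  beyond : ∀ {j} → q * 2 < j → coeff (fallingX^ 2 q) j ≡ 0ℚ
  beyond = coeff-fallingX^-> 2 {q}

  zero-left : ∀ y → -ℚ fromℕ q *ℚ 0ℚ +ℚ y ≡ y
  zero-left = solve 2 (λ x y → :- x :* con 0ℚ :+ y := y) refl (fromℕ q)

  step : ∀ j r → j + r ≡ 2 + q * 2 → Step j r
  step zero          (suc (suc r)) eq = add-terms {0} {2 + r} (σ r q) 0ℚ (coeff-fallingX² q 0 r r≡2q) refl
    (trans (cong (-ℚ fromℕ q *ℚ σ r q +ℚ_)
             (sym (σ-vanishes {2 + r} {q} (ℕ.m≤n⇒m≤1+n (s≤s (ℕ.≤-reflexive (sym r≡2q)))))))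
           (sym (σ-suc r q)))
    where r≡2q = suc-injective (suc-injective eq)
  step (suc zero)    (suc zero)    eq = add-terms {1} {1} 0ℚ 0ℚ
    (beyond (s≤s (ℕ.≤-reflexive (sym (suc-injective (suc-injective eq)))))) refl (zero-left 0ℚ)
  step (suc zero)    (suc (suc r)) eq = add-terms {1} {2 + r} (σ r q) 0ℚ (coeff-fallingX² q 1 r 1+r≡2q) refl
    (trans (cong (-ℚ fromℕ q *ℚ σ r q +ℚ_)
             (sym (σ-vanishes {2 + r} {q} (s≤s (ℕ.≤-reflexive (sym 1+r≡2q))))))
           (sym (σ-suc r q)))
    where 1+r≡2q = suc-injective (suc-injective eq)
  -- The exponent j + 2 exceeds the degree 2q of (x²)_q, so only the shifted term survives.
  step (suc (suc j)) zero          eq = add-terms {2 + j} {0} 0ℚ (σ 0 q)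
    (beyond (ℕ.m≤n⇒m≤1+n (s≤s (ℕ.≤-reflexive (trans (sym j+0≡2q) (+-identityʳ j))))))
    (coeff-fallingX² q j 0 j+0≡2q) (trans (zero-left (σ 0 q)) (trans (σ-0 q) (sym (σ-0 (suc q)))))
    where j+0≡2q = suc-injective (suc-injective eq)
  step (suc (suc j)) (suc zero)    eq = add-terms {2 + j} {1} 0ℚ 0ℚ
    (beyond (s≤s (ℕ.≤-reflexive (trans (sym j+1≡2q) (+-comm j 1)))))
    (coeff-fallingX² q j 1 j+1≡2q) (zero-left 0ℚ)
    where j+1≡2q = suc-injective (suc-injective eq)
  step (suc (suc j)) (suc (suc r)) eq = add-terms {2 + j} {2 + r} (σ r q) (σ (2 + r) q)
    (coeff-fallingX² q (2 + j) r (trans (sym (trans (+-suc j (suc r)) (cong suc (+-suc j r)))) j+r≡2q))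
    (coeff-fallingX² q j (2 + r) j+r≡2q) (sym (σ-suc r q))
    where j+r≡2q = suc-injective (suc-injective eq)

-- Exact depth of the two families

1≢0 : 1ℚ ≢ 0ℚ
1≢0 ()

X^q+X-exactDepth : IsTwoLevelOfExactDepth (λ q → X ^ₚ q +ₚ X) X (λ q → pred q ⊖1)
X^q+X-exactDepth = exactDepth pred twoLevel increasing disagrees
  where
  coeff-X^q+X : ∀ q k → coeff (X ^ₚ q +ₚ X) k ≡ coeff (X^ q) k +ℚ coeff X k
  coeff-X^q+X q k = trans (coeff-+ₚ (X ^ₚ q) X k) (cong (_+ℚ coeff X k) (coeff-X^ₚ q k))

  φ₁ : ℕ → Poly
  φ₁ zero    = 1ℚ ∷ []
  φ₁ (suc _) = []

  leading : ∀ q → coeff (X ^ₚ suc q +ₚ X) (suc q) ≢ 0ℚ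
  leading zero    ()
  leading (suc q) eq = 1≢0 (trans (sym (trans (coeff-X^q+X (2 + q) (2 + q))
    (cong (_+ℚ 0ℚ) (coeff-X^-diag (2 + q))))) eq)

  twoLevel : IsTwoLevel (λ q → X ^ₚ q +ₚ X) X (λ q → pred q ⊖1)
  twoLevel = record
    { deg      = λ q → q
    ; g-values = λ q → solve 1 (λ x → con 0ℚ :+ x :* (con 1ℚ :+ x :* con 0ℚ) := x) refl (fromℕ q)
    ; f-degree = degree
    ; φ        = φ₁
    ; agree    = λ q r r≤ → agreement q r ([]≤⊖1⇒< r≤)
    }
    where
    degree : ∀ q .{{_ : NonZero q}} → HasDegree (X ^ₚ q +ₚ X) q
    degree (suc q) = leading q , above
      where
      above : ∀ k → suc q < k → coeff (X ^ₚ suc q +ₚ X) k ≡ 0ℚ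
      above (suc zero)    (s≤s ())
      above (suc (suc k)) q<k = trans (coeff-X^q+X (suc q) (2 + k))
        (cong (_+ℚ 0ℚ) (coeff-X^-off (suc q) (2 + k) (ℕ.>⇒≢ q<k)))

    agreement : ∀ q .{{_ : NonZero q}} r → r < pred q →
                topCoeff (X ^ₚ q +ₚ X) q r ≡ eval (φ₁ r) (fromℕ q)
    -- The bound on r keeps the exponent, 2 + (n - r), above 1, so the summand `X` contributes 0.
    agreement (suc q) r (s≤s {n = n} r≤n) = trans
      (topCoeff-≡ (X ^ₚ suc q +ₚ X) {suc q} {2 + (n ∸ r)} {r} (cong (λ m → 2 + m) (ℕ.m∸n+n≡m r≤n)))
      (trans (coeff-X^q+X (suc q) (2 + (n ∸ r))) (values r r≤n))
      where
      values : ∀ r → r ≤ n → coeff (X^ (2 + n)) (2 + (n ∸ r)) +ℚ 0ℚ ≡ eval (φ₁ r) (fromℕ (2 + n))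
      values zero    _   = trans (cong (_+ℚ 0ℚ) (coeff-X^-diag n))
        (solve 1 (λ x → con 1ℚ := con 1ℚ :+ x :* con 0ℚ) refl (fromℕ (2 + n)))
      values (suc r) r<n = cong (_+ℚ 0ℚ) (coeff-X^-off n (n ∸ suc r) (ℕ.<⇒≢ (ℕ.∸-monoʳ-< (s≤s z≤n) r<n)))

  increasing : ∀ q .{{_ : NonZero q}} k → pred q < pred (suc q + k)
  increasing (suc q) k = s≤s (m≤m+n q k)

  disagrees : ∀ q .{{_ : NonZero q}} → topCoeff (X ^ₚ q +ₚ X) q (pred q) ≢ eval (φ₁ (pred q)) (fromℕ q)
  -- For q = 1 the two terms merge into 2x, whose leading coefficient 2 differs from the value 1 of
  -- `φ₁ 0`.
  disagrees (suc zero)    ()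
  disagrees (suc (suc q)) eq = 1≢0 (trans (sym (trans
    (topCoeff-≡ (X ^ₚ (2 + q) +ₚ X) {2 + q} {1} {suc q} refl)
    (trans (coeff-X^q+X (2 + q) 1) (cong (_+ℚ 1ℚ) (coeff-X^-off (2 + q) 1 λ ()))))) eq)

fallingX²+fallingX-exactDepth :
  IsTwoLevelOfExactDepth
    (λ q → falling polyRawRing (X ^ₚ 2) q +ₚ falling polyRawRing X q)
    (const 2 *ₚ X)
    (λ q → q ⊖1)
fallingX²+fallingX-exactDepth = exactDepth (λ q → q) twoLevel (λ q k → s≤s (m≤m+n q k)) (λ q → disagrees q)
  where
  -- `X ^ₚ 1` computes to `X`, so both summands are instances of `fallingX^`.
  f : ℕ → Poly
  f q = fallingX^ 2 q +ₚ fallingX^ 1 q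

  coeff-f : ∀ q k → coeff (f q) k ≡ coeff (fallingX^ 2 q) k +ℚ coeff (fallingX^ 1 q) k
  coeff-f q k = coeff-+ₚ (fallingX^ 2 q) (fallingX^ 1 q) k

  q*1<q*2 : ∀ q → suc q * 1 < suc q * 2
  q*1<q*2 q = ℕ.*-monoʳ-< (suc q) (s≤s (s≤s z≤n))

  q*2≡q+q : ∀ q → q * 2 ≡ q + q
  q*2≡q+q q = trans (ℕ.*-comm q 2) (cong (_+_ q) (+-identityʳ q))

  degree : ∀ q .{{_ : NonZero q}} → HasDegree (f q) (q * 2)
  degree (suc q) = (λ eq → 1≢0 (trans (sym top) eq)) , above
    where
    top : coeff (f (suc q)) (suc q * 2) ≡ 1ℚ
    top = trans (coeff-f (suc q) (suc q * 2))
      (cong₂ _+ℚ_ (coeff-fallingX^-top 2 (suc q)) (coeff-fallingX^-> 1 {suc q} (q*1<q*2 q)))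
    above : ∀ k → suc q * 2 < k → coeff (f (suc q)) k ≡ 0ℚ
    above k 2q<k = trans (coeff-f (suc q) k)
      (cong₂ _+ℚ_ (coeff-fallingX^-> 2 {suc q} 2q<k) (coeff-fallingX^-> 1 {suc q} (ℕ.<-trans (q*1<q*2 q) 2q<k)))

  -- The case r = q is included: for r < q the exponent exceeds the degree q of (x)_q and the second
  -- term is 0, while at r = q it is the leading coefficient 1.
  topCoeff-f : ∀ q r → r ≤ q → topCoeff (f q) (q * 2) r ≡ σ r q +ℚ coeff (fallingX^ 1 q) (q + (q ∸ r))
  topCoeff-f q r r≤q = trans (topCoeff-≡ (f q) {q * 2} {q + (q ∸ r)} {r} j+r)
    (trans (coeff-f q (q + (q ∸ r))) (cong (_+ℚ coeff (fallingX^ 1 q) (q + (q ∸ r)))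
      (coeff-fallingX² q (q + (q ∸ r)) r j+r)))
    where
    j+r : q + (q ∸ r) + r ≡ q * 2
    j+r = trans (ℕ.+-assoc q (q ∸ r) r) (trans (cong (_+_ q) (ℕ.m∸n+n≡m r≤q)) (sym (q*2≡q+q q)))

  twoLevel : IsTwoLevel (λ q → f q) (const 2 *ₚ X) (λ q → q ⊖1)
  twoLevel = record
    { deg      = λ q → q * 2
    ; g-values = λ q → trans (double (fromℕ q)) (sym (trans (cong fromℕ (q*2≡q+q q)) (fromℕ-+ q q)))
    ; f-degree = degree
    ; φ        = stirlingₚ
    ; agree    = λ q r r≤ → agreement q r ([]≤⊖1⇒< r≤)
    }
    where
    double : ∀ x → eval (const 2 *ₚ X) x ≡ x +ℚ x
    double = solve 1 (λ x → con 0ℚ :+ x :* (con (fromℕ 2) :+ x :* con 0ℚ) := x :+ x) refl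
    agreement : ∀ q r → r < q → topCoeff (f q) (q * 2) r ≡ eval (stirlingₚ r) (fromℕ q)
    agreement q r r<q = trans (topCoeff-f q r (ℕ.<⇒≤ r<q))
      (trans (cong (σ r q +ℚ_) (coeff-fallingX^-> 1 {q} (subst (_< q + (q ∸ r)) (sym (ℕ.*-identityʳ q))
               (ℕ.m<m+n q (ℕ.m<n⇒0<n∸m r<q)))))
             (ℚ.+-identityʳ (σ r q)))

  disagrees : ∀ q → topCoeff (f q) (q * 2) q ≢ eval (stirlingₚ q) (fromℕ q)
  disagrees q eq = 1≢0 (begin
    1ℚ                              ≡⟨ solve 1 (λ x → con 1ℚ := (x :+ con 1ℚ) :+ :- x) refl (σ q q) ⟩
    (σ q q +ℚ 1ℚ) +ℚ -ℚ σ q q       ≡⟨ cong (_+ℚ -ℚ σ q q) (trans (sym value) eq) ⟩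
    σ q q +ℚ -ℚ σ q q               ≡⟨ ℚ.+-inverseʳ (σ q q) ⟩
    0ℚ                              ∎)
    where
    open ≡-Reasoning
    q+[q∸q]≡q*1 : q + (q ∸ q) ≡ q * 1
    q+[q∸q]≡q*1 = trans (cong (_+_ q) (ℕ.n∸n≡0 q)) (trans (+-identityʳ q) (sym (ℕ.*-identityʳ q)))
    value : topCoeff (f q) (q * 2) q ≡ σ q q +ℚ 1ℚ
    value = trans (topCoeff-f q q ℕ.≤-refl)
      (cong (σ q q +ℚ_) (trans (cong (coeff (fallingX^ 1 q)) q+[q∸q]≡q*1) (coeff-fallingX^-top 1 q)))

proposition3p7 : ((∀ (q : ℕ) .{{_ : NonZero q}} (n : ℕ) → hom (S q) (S n) ≡ n ^ q + n)
    × IsTwoLevelOfExactDepth (λ q → X ^ₚ q +ₚ X) X (λ q → pred q ⊖1))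
    ×
    ((∀ (q : ℕ) .{{_ : NonZero q}} (n : ℕ) →
    + hom (K q) (K (n ^ 2) ⊔ K n) ≡ falling +-*-rawRing (+ (n ^ 2)) q +ℤ falling +-*-rawRing (+ n) q)
    × IsTwoLevelOfExactDepth
    (λ q → falling polyRawRing (X ^ₚ 2) q +ₚ falling polyRawRing X q)
    (const 2 *ₚ X)
    (λ q → q ⊖1))
proposition3p7 = (hom-S-S , X^q+X-exactDepth) , (hom-K-K⊔K , fallingX²+fallingX-exactDepth)
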